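{- Let $t=0$, $n\ge3$ and $1<\ell<n$. Consider the mTAZRP of type $\lambda$ on $n$ sites with parameters $x_1,\dots,x_n>0$, started at time $0$ from any configuration in which sites $\ell+1,\dots,n$ are empty. Then the law of the path $(W_s|_{[\ell]})_{s>0}$, where $W_s|_{[\ell]}=(W_s(1),\dots,W_s(\ell))$ is the configuration restricted to sites $1,\dots,\ell$, is unchanged when the parameters $x_{\ell+1},\dots,x_n$ are permuted (keeping $x_1,\dots,x_\ell$ fixed).
   Context: mTAZRP at $t=0$: for a partition $\lambda$, sites $1,\dots,n$ on a ring (site $n+1$ is site $1$); a configuration assigns to each site a multiset of species so that the union is the multiset of parts of $\lambda$ (larger label = stronger). With $t=0$, each nonempty site $j$, independently, at rate $x_j^{ -1}$ sends one particle of the largest species present at $j$ to site $j+1$; empty sites do nothing. -}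

module Defs where

open import Algebra.Apartness.Bundles using (HeytingField)
open import Axiom.UniquenessOfIdentityProofs using (module Decidable⇒UIP)
open import Data.Fin.Base using (Fin; zero; suc; toℕ)
open import Data.List.Base as List using (List; []; _∷_; map; foldr; upTo; allFin; cartesianProductWith)
open import Data.List.Membership.Propositional using (_∈_)
open import Data.List.Membership.Propositional.Properties using (∈-cartesianProductWith⁺; ∈-upTo⁺)
open import Data.List.Relation.Unary.All as All using (All; []; _∷_)
open import Data.List.Relation.Unary.AllPairs using ([]; _∷_)
open import Data.List.Relation.Unary.Any using (here; there)
open import Data.List.Relation.Unary.Linked using (Linked)
open import Data.List.Relation.Unary.Unique.Propositional using (Unique)
open import Data.List.Relation.Unary.Unique.Propositional.Properties using (cartesianProductWith⁺; upTo⁺)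
open import Data.Maybe.Base as Maybe using (Maybe; just; nothing; maybe′)
import Data.Maybe.Properties as Maybe
open import Data.Nat.Base as ℕ using (ℕ; zero; suc)
open import Data.Nat.DivMod using (_mod_)
import Data.Nat.Properties as ℕ
open import Data.Product.Base using (∃-syntax; _×_; _,_; proj₁)
open import Data.Sum.Base using (_⊎_)
open import Data.Vec.Base as Vec using (Vec; []; _∷_; lookup; replicate; zipWith; truncate; _[_]%=_)
import Data.Vec.Properties as Vec
open import Data.Vec.Relation.Binary.Pointwise.Inductive as Pointwise using (Pointwise; []; _∷_)
open import Data.Vec.Relation.Unary.All as VecAll using ([]; _∷_)
open import Level using (Level; _⊔_) renaming (suc to lsuc)
open import Relation.Binary.Core using (Rel)
open import Relation.Binary.Definitions using (DecidableEquality)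
open import Relation.Binary.PropositionalEquality
  using (_≡_; _≢_; refl; sym; trans; cong; cong₂; subst; setoid)
open import Relation.Binary.Structures using (IsStrictPartialOrder)
open import Relation.Nullary using (¬_; Dec; yes; no; contradiction)

open import Data.List.Relation.Unary.Enumerates.Setoid using (IsEnumeration)

record OrderedField (c ℓ₁ ℓ₂ ℓ₃ : Level) : Set (lsuc (c ⊔ ℓ₁ ⊔ ℓ₂ ⊔ ℓ₃)) where
  infix 4 _<_ _≤_ ∣_∣≤_

  field
    heytingField : HeytingField c ℓ₁ ℓ₂

  open HeytingField heytingField public

  field
    _<_                    : Rel Carrier ℓ₃
    <-isStrictPartialOrder : IsStrictPartialOrder _≈_ _<_
    <⇒#                    : ∀ {x y} → x < y → x # y
    #⇒<⊎>                  : ∀ {x y} → x # y → x < y ⊎ y < x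
    +-monoˡ-<              : ∀ z {x y} → x < y → x + z < y + z
    *-pos                  : ∀ {x y} → 0# < x → 0# < y → 0# < x * y

  _≤_ : Rel Carrier ℓ₃
  x ≤ y = ¬ (y < x)

  ∣_∣≤_ : Rel Carrier ℓ₃
  ∣ x ∣≤ y = - y ≤ x × x ≤ y

  fromℕ : ℕ → Carrier
  fromℕ zero    = 0#
  fromℕ (suc k) = 1# + fromℕ k

  Cauchy : (ℕ → Carrier) → Set (c ⊔ ℓ₃)
  Cauchy a = ∀ {ε} → 0# < ε →
    ∃[ N ] (∀ {i j} → N ℕ.≤ i → N ℕ.≤ j → ∣ a i - a j ∣≤ ε)

  _ConvergesTo_ : (ℕ → Carrier) → Carrier → Set (c ⊔ ℓ₃)
  a ConvergesTo x = ∀ {ε} → 0# < ε →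
    ∃[ N ] (∀ {i} → N ℕ.≤ i → ∣ a i - x ∣≤ ε)

  -- The library inverts differences: this is the inverse of x - 0#.
  recip : ∀ x → 0# < x → Carrier
  recip x 0<x = proj₁ (#⇒invertible (#-sym (<⇒# 0<x)))

  ∑ : ∀ {a} {A : Set a} → List A → (A → Carrier) → Carrier
  ∑ xs f = foldr (λ x acc → f x + acc) 0# xs

  𝟙 : ∀ {a} {A : Set a} → Dec A → Carrier
  𝟙 (yes _) = 1#
  𝟙 (no  _) = 0#

-- The real numbers, axiomatised as a Cauchy complete Archimedean ordered
-- field.  Order and apartness are the constructive ones (no trichotomy), so
-- that both the classical and the constructive reals are models.

record Reals (c ℓ₁ ℓ₂ ℓ₃ : Level) : Set (lsuc (c ⊔ ℓ₁ ⊔ ℓ₂ ⊔ ℓ₃)) where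
  field
    orderedField : OrderedField c ℓ₁ ℓ₂ ℓ₃

  open OrderedField orderedField public

  field
    archimedean : ∀ x → ∃[ k ] x < fromℕ k
    complete    : ∀ a → Cauchy a → ∃[ x ] a ConvergesTo x

record Finite (S : Set) : Set where
  infix 4 _≟_
  field
    _≟_         : DecidableEquality S
    elements    : List S
    enumeration : IsEnumeration (setoid S) elements
    unique      : Unique elements

module _ {c ℓ₁ ℓ₂ ℓ₃ : Level} (ℝ : Reals c ℓ₁ ℓ₂ ℓ₃) where

  open Reals ℝ

  module _ {S : Set} (finite : Finite S) where

    open Finite finite

    -- A continuous-time Markov chain on S that jumps from η to ζ ≢ η at rate
    -- q η ζ, with transition probabilities
    -- transition t η ζ = P (W (u + t) = ζ ∣ W u = η).
    -- Only times t ≥ 0 and off-diagonal values of q are constrained.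
    record JumpProcess (q : S → S → Carrier) : Set (c ⊔ ℓ₁ ⊔ ℓ₃) where
      field
        transition        : Carrier → S → S → Carrier
        transition-cong   : ∀ {t u} → 0# ≤ t → t ≈ u → ∀ η ζ →
                            transition t η ζ ≈ transition u η ζ
        nonnegative       : ∀ {t} → 0# ≤ t → ∀ η ζ → 0# ≤ transition t η ζ
        total             : ∀ {t} → 0# ≤ t → ∀ η → ∑ elements (transition t η) ≈ 1#
        initial           : ∀ η ζ → transition 0# η ζ ≈ 𝟙 (η ≟ ζ)
        chapmanKolmogorov : ∀ {t u} → 0# ≤ t → 0# ≤ u → ∀ η ζ →
          transition (t + u) η ζ ≈ ∑ elements λ ξ → transition t η ξ * transition u ξ ζ
        -- transition h η ζ = q η ζ h + o(h) as h ↓ 0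
        jumpRate          : ∀ {η ζ} → η ≢ ζ → ∀ {ε} → 0# < ε →
          ∃[ δ ] (0# < δ × (∀ {h} → 0# < h → h < δ →
            ∣ transition h η ζ - h * q η ζ ∣≤ ε * h))

    module _ {C : Set} (_≟C_ : DecidableEquality C) (f : S → C)
             {q : S → S → Carrier} (W : JumpProcess q) where

      open JumpProcess W

      -- Given W t = η, the probability that f (W u) = c for every (u , c) in
      -- the list, whose times are to be increasing and greater than t.
      cylinderProbability : Carrier → S → List (Carrier × C) → Carrier
      cylinderProbability t η []             = 1#
      cylinderProbability t η ((u , c) ∷ es) = ∑ elements λ ζ →
        𝟙 (f ζ ≟C c) * (transition (u - t) η ζ * cylinderProbability u ζ es)

    -- The paths (f (W s))_{s>0} and (f (W′ s))_{s>0}, both chains being started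
    -- from η at time 0, have the same law.  The law of a path is determined by
    -- its values on cylinder events, i.e. by its finite-dimensional
    -- distributions.
    SamePathLaw : {C : Set} → DecidableEquality C → (S → C) →
                  {q q′ : S → S → Carrier} → JumpProcess q → JumpProcess q′ →
                  S → Set (c ⊔ ℓ₁ ⊔ ℓ₃)
    SamePathLaw {C} _≟C_ f W W′ η =
      (es : List (Carrier × C)) → Linked _<_ (0# ∷ map proj₁ es) →
      cylinderProbability _≟C_ f W 0# η es ≈ cylinderProbability _≟C_ f W′ 0# η es

-- A multiset of species, given by multiplicities: i : Fin s stands for the
-- label i + 1, so that a partition λ = 1^{m₁} 2^{m₂} ⋯ s^{mₛ} (with parts at
-- most s) is the multiset of species m₁ ∷ m₂ ∷ ⋯ ∷ mₛ ∷ [].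

Multiset : ℕ → Set
Multiset s = Vec ℕ s

∅ : ∀ {s} → Multiset s
∅ {s} = replicate s 0

_⊎ₘ_ : ∀ {s} → Multiset s → Multiset s → Multiset s
_⊎ₘ_ = zipWith ℕ._+_

strongest : ∀ {s} → Multiset s → Maybe (Fin s)
strongest []           = nothing
strongest (zero ∷ m)  = Maybe.map suc (strongest m)
strongest (suc _ ∷ m)  = just (maybe′ suc zero (strongest m))

Sites : ℕ → ℕ → Set
Sites n s = Vec (Multiset s) n

_≟ₘ_ : ∀ {s} → DecidableEquality (Multiset s)
_≟ₘ_ = Vec.≡-dec ℕ._≟_

_≟ₛ_ : ∀ {n s} → DecidableEquality (Sites n s)
_≟ₛ_ = Vec.≡-dec _≟ₘ_

content : ∀ {n s} → Sites n s → Multiset s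
content = Vec.foldr _ _⊎ₘ_ ∅

record Config (n : ℕ) {s : ℕ} (type : Multiset s) : Set where
  constructor _,_
  field
    sites        : Sites n s
    content≡type : content sites ≡ type

open Config public

next : ∀ {n} → Fin n → Fin n
next {suc n} j = suc (toℕ j) mod suc n

hop : ∀ {n s} → Fin n → Sites n s → Maybe (Sites n s)
hop j η = Maybe.map move (strongest (lookup η j))
  where move = λ i → (η [ j ]%= (_[ i ]%= ℕ.pred)) [ next j ]%= (_[ i ]%= suc)

restrict : ∀ {n s ℓ} {type : Multiset s} → ℓ ℕ.≤ n → Config n type → Sites ℓ s
restrict ℓ≤n η = truncate ℓ≤n (sites η)

submultisets : ∀ {s} → Multiset s → List (Multiset s)
submultisets []      = [] ∷ []
submultisets (k ∷ m) = cartesianProductWith _∷_ (upTo (suc k)) (submultisets m)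

vectors : ∀ {a} {A : Set a} → List A → ∀ n → List (Vec A n)
vectors xs zero    = [] ∷ []
vectors xs (suc n) = cartesianProductWith _∷_ xs (vectors xs n)

withContent : ∀ {n s} (type : Multiset s) → List (Sites n s) → List (Config n type)
withContent type []       = []
withContent type (η ∷ ηs) with content η ≟ₘ type
... | yes eq = (η , eq) ∷ withContent type ηs
... | no  _  = withContent type ηs

configs : ∀ n {s} (type : Multiset s) → List (Config n type)
configs n type = withContent type (vectors (submultisets type) n)

module _ {n s : ℕ} {type : Multiset s} where

  sites-injective : ∀ {η ζ : Config n type} → sites η ≡ sites ζ → η ≡ ζ
  sites-injective {η , p} {.η , q} refl =
    cong (η ,_) (Decidable⇒UIP.≡-irrelevant _≟ₘ_ p q)

  _≟-config_ : DecidableEquality (Config n type)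
  η ≟-config ζ with sites η ≟ₛ sites ζ
  ... | yes eq  = yes (sites-injective eq)
  ... | no  neq = no λ { refl → neq refl }

private
  _⊆ₘ_ : ∀ {s} → Multiset s → Multiset s → Set
  _⊆ₘ_ = Pointwise ℕ._≤_

  ∈-submultisets : ∀ {s} {m m′ : Multiset s} → m ⊆ₘ m′ → m ∈ submultisets m′
  ∈-submultisets []         = here refl
  ∈-submultisets (k≤k′ ∷ p) =
    ∈-cartesianProductWith⁺ _∷_ (∈-upTo⁺ (ℕ.s≤s k≤k′)) (∈-submultisets p)

  submultisets-unique : ∀ {s} (m : Multiset s) → Unique (submultisets m)
  submultisets-unique []      = [] ∷ []
  submultisets-unique (k ∷ m) =
    cartesianProductWith⁺ _∷_ Vec.∷-injective (upTo⁺ (suc k)) (submultisets-unique m)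

  ∈-vectors : ∀ {a} {A : Set a} {xs : List A} {n} {v : Vec A n} →
              VecAll.All (_∈ xs) v → v ∈ vectors xs n
  ∈-vectors []       = here refl
  ∈-vectors (p ∷ ps) = ∈-cartesianProductWith⁺ _∷_ p (∈-vectors ps)

  vectors-unique : ∀ {a} {A : Set a} {xs : List A} → Unique xs → ∀ n → Unique (vectors xs n)
  vectors-unique xs! zero    = [] ∷ []
  vectors-unique xs! (suc n) =
    cartesianProductWith⁺ _∷_ Vec.∷-injective xs! (vectors-unique xs! n)

  ⊆-⊎ₘˡ : ∀ {s} (m m′ : Multiset s) → m ⊆ₘ (m ⊎ₘ m′)
  ⊆-⊎ₘˡ []      []        = []
  ⊆-⊎ₘˡ (k ∷ m) (k′ ∷ m′) = ℕ.m≤m+n k k′ ∷ ⊆-⊎ₘˡ m m′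

  ⊆-⊎ₘʳ : ∀ {s} (m m′ : Multiset s) → m′ ⊆ₘ (m ⊎ₘ m′)
  ⊆-⊎ₘʳ []      []        = []
  ⊆-⊎ₘʳ (k ∷ m) (k′ ∷ m′) = ℕ.m≤n+m k′ k ∷ ⊆-⊎ₘʳ m m′

  site⊆content : ∀ {n s} (η : Sites n s) → VecAll.All (_⊆ₘ content η) η
  site⊆content []      = []
  site⊆content (m ∷ η) = ⊆-⊎ₘˡ m (content η) ∷
    VecAll.map (λ p → Pointwise.trans ℕ.≤-trans p (⊆-⊎ₘʳ m (content η))) (site⊆content η)

  ∈-withContent : ∀ {n s} {type : Multiset s} {ηs : List (Sites n s)} (η : Config n type) →
                  sites η ∈ ηs → η ∈ withContent type ηs
  ∈-withContent {type = type} {ζ ∷ _} η (here refl) with content ζ ≟ₘ type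
  ... | yes _  = here (sites-injective refl)
  ... | no neq = contradiction (content≡type η) neq
  ∈-withContent {type = type} {ζ ∷ _} η (there p) with content ζ ≟ₘ type
  ... | yes _ = there (∈-withContent η p)
  ... | no  _ = ∈-withContent η p

  withContent-≢ : ∀ {n s} {type : Multiset s} {η : Config n type} {ηs : List (Sites n s)} →
                  All (sites η ≢_) ηs → All (η ≢_) (withContent type ηs)
  withContent-≢ [] = []
  withContent-≢ {type = type} {ηs = ζ ∷ _} (η≢ζ ∷ ps) with content ζ ≟ₘ type
  ... | yes _ = (λ { refl → η≢ζ refl }) ∷ withContent-≢ ps
  ... | no  _ = withContent-≢ ps

  withContent-unique : ∀ {n s} {type : Multiset s} {ηs : List (Sites n s)} →
                       Unique ηs → Unique (withContent type ηs)
  withContent-unique [] = []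
  withContent-unique {type = type} {ηs = ζ ∷ _} (p ∷ ps) with content ζ ≟ₘ type
  ... | yes _ = withContent-≢ p ∷ withContent-unique ps
  ... | no  _ = withContent-unique ps

finiteConfig : ∀ n {s} (type : Multiset s) → Finite (Config n type)
finiteConfig n type = record
  { _≟_         = _≟-config_
  ; elements    = configs n type
  ; enumeration = λ { (η , refl) → ∈-withContent (η , refl)
                      (∈-vectors (VecAll.map ∈-submultisets (site⊆content η))) }
  ; unique      = withContent-unique (vectors-unique (submultisets-unique type) n)
  }

module _ {c ℓ₁ ℓ₂ ℓ₃ : Level} (ℝ : Reals c ℓ₁ ℓ₂ ℓ₃) {n s : ℕ} (type : Multiset s) where

  open Reals ℝ

  module _ (x : Fin n → Carrier) (x>0 : ∀ j → 0# < x j) where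

    hopRate : Config n type → Config n type → Carrier
    hopRate η ζ = ∑ (allFin n) λ j →
      𝟙 (Maybe.≡-dec _≟ₛ_ (hop j (sites η)) (just (sites ζ))) * recip (x j) (x>0 j)

    mTAZRP : Set (c ⊔ ℓ₁ ⊔ ℓ₃)
    mTAZRP = JumpProcess ℝ (finiteConfig n type) hopRate

{-# OPTIONS --safe #-}

-- Interchangeability of two neighbouring unobserved sites a, b with exponential
-- clocks of rates α and β = αρ is witnessed by a signed kernel K: the particles at
-- a stay put, and of the particles at b the strongest min(G, |B|) stay while the
-- others go back to a, where P(G = k) = ρᵏ(1 − ρ).  For ρ < 1 this is the
-- equilibrium queue length at b under the interchanged rates; for ρ > 1 some
-- weights are negative, which does no harm.  K changes neither the other sites nor
-- configurations with a and b empty, and it intertwines the generators with the two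
-- rates interchanged.  Composing such kernels along adjacent transpositions gives
-- the kernel of an arbitrary permutation of the unobserved parameters.  A
-- telescoping argument passes from the generators to the transition semigroups, so
-- that the processes with the intermediate parameters need not be constructed.

module Submission where

open import Defs
open import Algebra.Apartness.Bundles using (HeytingCommutativeRing)
import Algebra.Apartness.Properties.HeytingCommutativeRing as HeytingProperties
open import Algebra.Bundles using (CommutativeRing; RawRing)
import Algebra.Properties.Ring as RingProperties
import Algebra.Properties.Semiring.Mult.TCOptimised as Mult
import Algebra.Solver.Ring as RingSolver
open import Algebra.Solver.Ring.AlmostCommutativeRing using (fromCommutativeRing; _-Raw-AlmostCommutative⟶_)
open import Data.Fin.Base as Fin using (Fin; zero; suc; toℕ)
open import Data.Fin.Permutation using (Permutation′; _⟨$⟩ʳ_; _⟨$⟩ˡ_; inverseˡ; lift₀-remove; _∘ₚ_; transpose)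
  renaming (remove to removeₚ)
import Data.Fin.Permutation.Components as Components
open import Data.Fin.Permutation.Transposition.List using (decompose; eval; eval-decompose)
import Data.Fin.Properties as Fin
open import Data.List.Base as List using (List; []; _∷_; _++_; length; map; allFin)
open import Data.List.Membership.Propositional using (_∈_)
open import Data.List.Membership.Propositional.Properties using (∈-allFin)
open import Data.List.Relation.Unary.All as All using (All; []; _∷_)
open import Data.List.Relation.Unary.All.Properties using (map⁺)
open import Data.List.Relation.Unary.AllPairs using ([]; _∷_)
open import Data.List.Relation.Unary.Any using (here; there)
open import Data.List.Relation.Unary.Linked using (Linked; _∷_)
open import Data.List.Relation.Unary.Unique.Propositional using (Unique)
open import Data.List.Relation.Unary.Unique.Propositional.Properties using (allFin⁺)
open import Data.Maybe.Base as Maybe using (Maybe; just; nothing; maybe′)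
import Data.Maybe.Properties as Maybe
open import Data.Nat.Base as ℕ using (ℕ; zero; suc)
open import Data.Nat.DivMod using (_%_; n%n≡0; m<n⇒m%n≡m)
import Data.Nat.Properties as ℕ
open import Data.Nat.Properties using (<⇒≤)
open import Data.Product.Base using (∃-syntax; _×_; _,_; proj₁; proj₂)
open import Data.Sum.Base as Sum using (_⊎_; inj₁; inj₂; [_,_]′)
open import Data.Vec.Base as Vec using (Vec; []; _∷_; lookup; truncate; _[_]%=_; _[_]≔_)
import Data.Vec.Properties as Vec
open import Function.Base using (_∘_; id)
open import Level using (Level; _⊔_; 0ℓ)
open import Relation.Binary.Core using (Rel)
open import Relation.Binary.Definitions using (DecidableEquality; tri<; tri≈; tri>)
open import Relation.Binary.PropositionalEquality as ≡ using (_≡_; _≢_; _≗_)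
import Relation.Binary.Reasoning.Setoid as SetoidReasoning
open import Relation.Binary.Structures using (IsStrictPartialOrder)
open import Relation.Nullary using (¬_; Dec; yes; no; contradiction)

-- The intertwining is of backward type: L K = K L′ for the generators, hence P K = K P′ for the
-- semigroups. As K commutes with multiplication by functions of the observed sites and fixes the
-- constant 1, it can be pulled out of a cylinder probability one observation time after another; at
-- time 0 it disappears because the unobserved sites are empty.
--
-- The order of the reals does not decide between ρ < 1, ρ = 1 and ρ > 1, so one formula has to
-- serve for all ρ. Truncation at |B| provides it: the weight of k is ρᵏ(1 - ρ) for k < |B| and ρᵏ
-- for k = |B|. These are polynomials with sum 1, and no limit is involved. The generator identity
-- becomes a polynomial identity, proved by peeling off the strongest particle.
--
-- Keeping the strongest particles at b is what makes the one-species kernel compatible with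
-- priorities: for every i, the particles of species at least i that stay number min(G, |B_{≥i}|),
-- with the same G. Signs of weights do not matter in the limit argument, which uses linearity, K 1
-- = 1 and some finite norm.

-- Polynomial identities in commutative rings, with integer coefficients

module CommutativeRingSolver {c ℓ} (R : CommutativeRing c ℓ) where

  open CommutativeRing R
  open RingProperties ring using (-‿distribˡ-*; -‿distribʳ-*; -‿involutive; -0#≈0#; -‿+-comm)
  open Mult semiring using (1+×; ×-homo-+; ×1-homo-*) renaming (_×_ to _×ₙ_)
  open SetoidReasoning setoid

  private
    -- (m , n) stands for m − n; normalised so that one component is zero.
    Coefficient : Set
    Coefficient = ℕ × ℕ

    normalise : Coefficient → Coefficient
    normalise (m , n) = m ℕ.∸ n , n ℕ.∸ m

    ι : ℕ → Carrier
    ι n = n ×ₙ 1#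

    -- The separate case for a zero second component makes the constants 0 and 1 evaluate
    -- definitionally to `0#` and `1#`, as solver goals require.
    ⟦_⟧ᶜ : Coefficient → Carrier
    ⟦ m , zero  ⟧ᶜ = ι m
    ⟦ m , suc n ⟧ᶜ = ι m - ι (suc n)

    ⟦⟧-difference : ∀ m n → ⟦ m , n ⟧ᶜ ≈ ι m - ι n
    ⟦⟧-difference m zero    = sym (trans (+-congˡ -0#≈0#) (+-identityʳ _))
    ⟦⟧-difference m (suc n) = refl

    interchange : ∀ a b c d → (a + b) + (c + d) ≈ (a + c) + (b + d)
    interchange a b c d = begin
      (a + b) + (c + d) ≈⟨ +-assoc a b _ ⟩
      a + (b + (c + d)) ≈⟨ +-congˡ (+-assoc b c d) ⟨
      a + ((b + c) + d) ≈⟨ +-congˡ (+-congʳ (+-comm b c)) ⟩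
      a + ((c + b) + d) ≈⟨ +-congˡ (+-assoc c b d) ⟩
      a + (c + (b + d)) ≈⟨ +-assoc a c _ ⟨
      (a + c) + (b + d) ∎

    difference-+ : ∀ a b c d → (a + c) - (b + d) ≈ (a - b) + (c - d)
    difference-+ a b c d = trans (+-congˡ (sym (-‿+-comm b d))) (interchange a c (- b) (- d))

    difference-* : ∀ a b c d → (a * c + b * d) - (a * d + b * c) ≈ (a - b) * (c - d)
    difference-* a b c d = sym (begin
      (a - b) * (c - d)                                   ≈⟨ distribʳ (c - d) a (- b) ⟩
      a * (c - d) + - b * (c - d)                         ≈⟨ +-cong (distribˡ a c (- d)) (distribˡ (- b) c (- d)) ⟩
      (a * c + a * - d) + (- b * c + - b * - d)           ≈⟨ +-cong (+-congˡ (sym (-‿distribʳ-* a d)))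
                                                               (+-cong (sym (-‿distribˡ-* b c)) negneg) ⟩
      (a * c + - (a * d)) + (- (b * c) + b * d)           ≈⟨ +-congˡ (+-comm _ _) ⟩
      (a * c + - (a * d)) + (b * d + - (b * c))           ≈⟨ interchange _ _ _ _ ⟩
      (a * c + b * d) + (- (a * d) + - (b * c))           ≈⟨ +-congˡ (-‿+-comm _ _) ⟩
      (a * c + b * d) - (a * d + b * c)                   ∎)
      where
      negneg : - b * - d ≈ b * d
      negneg = trans (sym (-‿distribˡ-* b (- d)))
        (trans (-‿cong (sym (-‿distribʳ-* b d))) (-‿involutive _))

    ⟦normalise⟧ : ∀ m n → ⟦ normalise (m , n) ⟧ᶜ ≈ ι m - ι n
    ⟦normalise⟧ zero    zero    = ⟦⟧-difference 0 0
    ⟦normalise⟧ zero    (suc n) = ⟦⟧-difference 0 (suc n)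
    ⟦normalise⟧ (suc m) zero    = ⟦⟧-difference (suc m) 0
    ⟦normalise⟧ (suc m) (suc n) = begin
      ⟦ normalise (m , n) ⟧ᶜ       ≈⟨ ⟦normalise⟧ m n ⟩
      ι m - ι n                   ≈⟨ +-identityˡ _ ⟨
      0# + (ι m - ι n)            ≈⟨ +-congʳ (-‿inverseʳ 1#) ⟨
      (1# - 1#) + (ι m - ι n)     ≈⟨ difference-+ 1# 1# (ι m) (ι n) ⟨
      (1# + ι m) - (1# + ι n)     ≈⟨ +-cong (1+× m 1#) (-‿cong (1+× n 1#)) ⟨
      ι (suc m) - ι (suc n)       ∎

    coefficients : RawRing 0ℓ 0ℓ
    coefficients = record
      { Carrier = Coefficient
      ; _≈_     = _≡_
      ; _+_     = λ (a , b) (c , d) → normalise (a ℕ.+ c , b ℕ.+ d)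
      ; _*_     = λ (a , b) (c , d) → normalise (a ℕ.* c ℕ.+ b ℕ.* d , a ℕ.* d ℕ.+ b ℕ.* c)
      ; -_      = λ (a , b) → b , a
      ; 0#      = 0 , 0
      ; 1#      = 1 , 0
      }

    morphism : coefficients -Raw-AlmostCommutative⟶ fromCommutativeRing R
    morphism = record
      { ⟦_⟧    = ⟦_⟧ᶜ
      ; +-homo = λ (a , b) (c , d) → begin
          ⟦ normalise (a ℕ.+ c , b ℕ.+ d) ⟧ᶜ ≈⟨ ⟦normalise⟧ (a ℕ.+ c) (b ℕ.+ d) ⟩
          ι (a ℕ.+ c) - ι (b ℕ.+ d)         ≈⟨ +-cong (×-homo-+ 1# a c) (-‿cong (×-homo-+ 1# b d)) ⟩
          (ι a + ι c) - (ι b + ι d)         ≈⟨ difference-+ _ _ _ _ ⟩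
          (ι a - ι b) + (ι c - ι d)         ≈⟨ +-cong (⟦⟧-difference a b) (⟦⟧-difference c d) ⟨
          ⟦ a , b ⟧ᶜ + ⟦ c , d ⟧ᶜ             ∎
      ; *-homo = λ (a , b) (c , d) → begin
          ⟦ normalise (a ℕ.* c ℕ.+ b ℕ.* d , a ℕ.* d ℕ.+ b ℕ.* c) ⟧ᶜ
            ≈⟨ ⟦normalise⟧ (a ℕ.* c ℕ.+ b ℕ.* d) (a ℕ.* d ℕ.+ b ℕ.* c) ⟩
          ι (a ℕ.* c ℕ.+ b ℕ.* d) - ι (a ℕ.* d ℕ.+ b ℕ.* c)
            ≈⟨ +-cong (ι-homo a c b d) (-‿cong (ι-homo a d b c)) ⟩
          (ι a * ι c + ι b * ι d) - (ι a * ι d + ι b * ι c)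
            ≈⟨ difference-* _ _ _ _ ⟩
          (ι a - ι b) * (ι c - ι d)
            ≈⟨ *-cong (⟦⟧-difference a b) (⟦⟧-difference c d) ⟨
          ⟦ a , b ⟧ᶜ * ⟦ c , d ⟧ᶜ ∎
      ; -‿homo = λ (a , b) → begin
          ⟦ b , a ⟧ᶜ          ≈⟨ ⟦⟧-difference b a ⟩
          ι b - ι a           ≈⟨ +-comm _ _ ⟩
          - ι a + ι b         ≈⟨ +-congˡ (-‿involutive _) ⟨
          - ι a + - - ι b     ≈⟨ -‿+-comm _ _ ⟩
          - (ι a - ι b)       ≈⟨ -‿cong (⟦⟧-difference a b) ⟨
          - ⟦ a , b ⟧ᶜ        ∎
      ; 0-homo = refl
      ; 1-homo = refl
      }
      where
      ι-homo : ∀ a c b d → ι (a ℕ.* c ℕ.+ b ℕ.* d) ≈ ι a * ι c + ι b * ι d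
      ι-homo a c b d = trans (×-homo-+ 1# (a ℕ.* c) (b ℕ.* d))
        (+-cong (×1-homo-* a c) (×1-homo-* b d))

    coefficient≟ : ∀ p q → Maybe (⟦ p ⟧ᶜ ≈ ⟦ q ⟧ᶜ)
    coefficient≟ (a , b) (c , d) with a ℕ.≟ c | b ℕ.≟ d
    ... | yes ≡.refl | yes ≡.refl = just refl
    ... | _          | _          = nothing

  open RingSolver coefficients (fromCommutativeRing R) morphism coefficient≟ public
    using (solve; _:=_; _:+_; _:*_; _:-_; :-_; con)

  :0 :1 : ∀ {n} → RingSolver.Polynomial coefficients (fromCommutativeRing R) morphism coefficient≟ n
  :0 = con (0 , 0)
  :1 = con (1 , 0)

-- Constructive order, bounds and finite sums in an ordered field

module OrderedFieldProperties {c ℓ₁ ℓ₂ ℓ₃} (F : OrderedField c ℓ₁ ℓ₂ ℓ₃) where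

  open OrderedField F public

  open IsStrictPartialOrder <-isStrictPartialOrder public
    using (<-respʳ-≈; <-respˡ-≈) renaming (trans to <-trans; irrefl to <-irrefl; asym to <-asym)
  open HeytingProperties heytingCommutativeRing public using (1#0; #-congʳ)
  open CommutativeRingSolver (HeytingCommutativeRing.commutativeRing heytingCommutativeRing) public
  open SetoidReasoning setoid

  x<y⇒0<y-x : ∀ {x y} → x < y → 0# < y - x
  x<y⇒0<y-x {x} x<y = <-respˡ-≈ (-‿inverseʳ x) (+-monoˡ-< (- x) x<y)

  0<y-x⇒x<y : ∀ {x y} → 0# < y - x → x < y
  0<y-x⇒x<y {x} {y} p = <-respˡ-≈ (+-identityˡ x)
    (<-respʳ-≈ (solve 2 (λ x y → y :- x :+ x := y) refl x y) (+-monoˡ-< x p))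

  <-by : ∀ {x y e} → 0# < e → y - x ≈ e → x < y
  <-by 0<e eq = 0<y-x⇒x<y (<-respʳ-≈ (sym eq) 0<e)

  -- The substitute for trichotomy: apartness is cotransitive, and each of the two resulting
  -- apartnesses splits into strict inequalities.
  <-cotrans : ∀ {x y} → x < y → ∀ z → x < z ⊎ z < y
  <-cotrans x<y z with #-cotrans (<⇒# x<y) z
  ... | inj₁ x#z with #⇒<⊎> x#z
  ...   | inj₁ x<z = inj₁ x<z
  ...   | inj₂ z<x = inj₂ (<-trans z<x x<y)
  <-cotrans x<y z | inj₂ z#y with #⇒<⊎> z#y
  ...   | inj₁ z<y = inj₂ z<y
  ...   | inj₂ y<z = inj₁ (<-trans x<y y<z)

  <-weaken : ∀ {x y} → x < y → x ≤ y
  <-weaken x<y y<x = <-asym x<y y<x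

  ≤-refl : ∀ {x} → x ≤ x
  ≤-refl = <-irrefl refl

  ≤-respˡ-≈ : ∀ {x y z} → x ≈ y → x ≤ z → y ≤ z
  ≤-respˡ-≈ x≈y x≤z z<y = x≤z (<-respʳ-≈ (sym x≈y) z<y)

  ≤-respʳ-≈ : ∀ {x y z} → x ≈ y → z ≤ x → z ≤ y
  ≤-respʳ-≈ x≈y z≤x y<z = z≤x (<-respˡ-≈ (sym x≈y) y<z)

  ≤-trans : ∀ {x y z} → x ≤ y → y ≤ z → x ≤ z
  ≤-trans {y = y} x≤y y≤z z<x = [ y≤z , x≤y ]′ (<-cotrans z<x y)

  <-≤-trans : ∀ {x y z} → x < y → y ≤ z → x < z
  <-≤-trans {z = z} x<y y≤z with <-cotrans x<y z
  ... | inj₁ x<z = x<z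
  ... | inj₂ z<y = contradiction z<y y≤z

  ≤-antisym : ∀ {x y} → x ≤ y → y ≤ x → x ≈ y
  ≤-antisym {x} {y} x≤y y≤x = proj₁ (tight x y) λ x#y → [ y≤x , x≤y ]′ (#⇒<⊎> x#y)

  0≤y-x⇒x≤y : ∀ {x y} → 0# ≤ y - x → x ≤ y
  0≤y-x⇒x≤y {x} {y} p y<x = p (<-by (x<y⇒0<y-x y<x)
    (solve 2 (λ x y → :0 :- (y :- x) := x :- y) refl x y))

  x≤y⇒0≤y-x : ∀ {x y} → x ≤ y → 0# ≤ y - x
  x≤y⇒0≤y-x {x} {y} x≤y p = x≤y (<-by (x<y⇒0<y-x p)
    (solve 2 (λ x y → x :- y := :0 :- (y :- x)) refl x y))

  ≤-by : ∀ {x y e} → 0# ≤ e → y - x ≈ e → x ≤ y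
  ≤-by 0≤e eq = 0≤y-x⇒x≤y (≤-respʳ-≈ (sym eq) 0≤e)

  +-nonneg : ∀ {x y} → 0# ≤ x → 0# ≤ y → 0# ≤ x + y
  +-nonneg {x} {y} 0≤x 0≤y = ≤-trans 0≤y (≤-by 0≤x (solve 2 (λ x y → x :+ y :- y := x) refl x y))

  +-mono-≤ : ∀ {x y u v} → x ≤ y → u ≤ v → x + u ≤ y + v
  +-mono-≤ {x} {y} {u} {v} x≤y u≤v = ≤-by (+-nonneg (x≤y⇒0≤y-x x≤y) (x≤y⇒0≤y-x u≤v))
    (solve 4 (λ x y u v → y :+ v :- (x :+ u) := (y :- x) :+ (v :- u)) refl x y u v)

  0<1 : 0# < 1#
  0<1 with #⇒<⊎> 1#0
  ... | inj₂ 0<1 = 0<1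
  ... | inj₁ 1<0 = contradiction
    (<-respʳ-≈ (solve 0 ((:0 :- :1) :* (:0 :- :1) := :1) refl) (*-pos (x<y⇒0<y-x 1<0) (x<y⇒0<y-x 1<0)))
    (<-weaken 1<0)

  invertible⇒#0 : ∀ {x} y → y * x ≈ 1# → x # 0#
  invertible⇒#0 {x} y yx≈1 = invertible⇒#
    (y , trans (solve 2 (λ x y → y :* (x :- :0) := y :* x) refl x y) yx≈1
       , trans (solve 2 (λ x y → (x :- :0) :* y := y :* x) refl x y) yx≈1)

  factor#0 : ∀ {x y} → x * y # 0# → x # 0#
  factor#0 {x} {y} xy#0 with #⇒invertible xy#0
  ... | z , zxy≈1 , _ = invertible⇒#0 (z * y)
    (trans (solve 3 (λ x y z → z :* y :* x := z :* (x :* y :- :0)) refl x y z) zxy≈1)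

  #0∧0≤⇒0< : ∀ {x} → x # 0# → 0# ≤ x → 0# < x
  #0∧0≤⇒0< x#0 0≤x with #⇒<⊎> x#0
  ... | inj₁ x<0 = contradiction x<0 0≤x
  ... | inj₂ 0<x = 0<x

  -- Since `≤` is a negation, x y < 0 may be assumed. Then x y is invertible, so both factors are
  -- apart from 0, hence positive, and `*-pos` gives a contradiction.
  *-nonneg : ∀ {x y} → 0# ≤ x → 0# ≤ y → 0# ≤ x * y
  *-nonneg {x} {y} 0≤x 0≤y xy<0 = <-asym xy<0 (*-pos (#0∧0≤⇒0< x#0 0≤x) (#0∧0≤⇒0< y#0 0≤y))
    where
    x#0 = factor#0 (<⇒# xy<0)
    y#0 = factor#0 (#-congʳ (*-comm x y) (<⇒# xy<0))

  *-monoʳ-≤ : ∀ {z x y} → 0# ≤ z → x ≤ y → z * x ≤ z * y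
  *-monoʳ-≤ {z} {x} {y} 0≤z x≤y = ≤-by (*-nonneg 0≤z (x≤y⇒0≤y-x x≤y))
    (solve 3 (λ x y z → z :* y :- z :* x := z :* (y :- x)) refl x y z)

  *-monoˡ-< : ∀ {z x y} → 0# < z → x < y → x * z < y * z
  *-monoˡ-< {z} {x} {y} 0<z x<y = <-by (*-pos (x<y⇒0<y-x x<y) 0<z)
    (solve 3 (λ x y z → y :* z :- x :* z := (y :- x) :* z) refl x y z)

  recip-inverseˡ : ∀ x (0<x : 0# < x) → recip x 0<x * x ≈ 1#
  recip-inverseˡ x 0<x with #⇒invertible (#-sym (<⇒# 0<x))
  ... | y , y[x-0]≈1 , _ = trans (solve 2 (λ x y → y :* x := y :* (x :- :0)) refl x y) y[x-0]≈1

  inverse-pos : ∀ {x y} → 0# < x → y * x ≈ 1# → 0# < y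
  inverse-pos {x} {y} 0<x yx≈1 = [ (λ y<0 → contradiction (1<0 y<0) (<-weaken 0<1)) , (λ 0<y → 0<y) ]′
    (#⇒<⊎> y#0)
    where
    y#0 : y # 0#
    y#0 = invertible⇒#0 x (trans (*-comm x y) yx≈1)
    1<0 : y < 0# → 1# < 0#
    1<0 y<0 = <-respʳ-≈ (zeroˡ x) (<-respˡ-≈ yx≈1 (*-monoˡ-< 0<x y<0))

  fromℕ-nonneg : ∀ k → 0# ≤ fromℕ k
  fromℕ-nonneg zero    = ≤-refl
  fromℕ-nonneg (suc k) = +-nonneg (<-weaken 0<1) (fromℕ-nonneg k)

  fromℕ-pos : ∀ k → 0# < fromℕ (suc k)
  fromℕ-pos k = <-≤-trans 0<1 (≤-by (fromℕ-nonneg k)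
    (solve 1 (λ k → :1 :+ k :- :1 := k) refl (fromℕ k)))

  fromℕ-mono : ∀ {j k} → j ℕ.≤ k → fromℕ j ≤ fromℕ k
  fromℕ-mono {k = k} ℕ.z≤n = fromℕ-nonneg k
  fromℕ-mono (ℕ.s≤s j≤k)   = +-mono-≤ ≤-refl (fromℕ-mono j≤k)

  ∣∣≤-cong : ∀ {x y a b} → x ≈ y → a ≈ b → ∣ x ∣≤ a → ∣ y ∣≤ b
  ∣∣≤-cong x≈y a≈b (l , u) = ≤-respˡ-≈ (-‿cong a≈b) (≤-respʳ-≈ x≈y l) ,
                             ≤-respˡ-≈ x≈y (≤-respʳ-≈ a≈b u)

  ∣∣≤-congˡ : ∀ {x y a} → x ≈ y → ∣ x ∣≤ a → ∣ y ∣≤ a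
  ∣∣≤-congˡ x≈y = ∣∣≤-cong x≈y refl

  ∣∣≤-weaken : ∀ {x a b} → a ≤ b → ∣ x ∣≤ a → ∣ x ∣≤ b
  ∣∣≤-weaken {a = a} {b} a≤b (l , u) =
    ≤-trans (≤-by (x≤y⇒0≤y-x a≤b) (solve 2 (λ a b → :- a :- :- b := b :- a) refl a b)) l ,
    ≤-trans u a≤b

  ∣0∣≤ : ∀ {a} → 0# ≤ a → ∣ 0# ∣≤ a
  ∣0∣≤ {a} 0≤a = ≤-by 0≤a (solve 1 (λ a → :0 :- :- a := a) refl a) , 0≤a

  ∣+∣≤ : ∀ {x y a b} → ∣ x ∣≤ a → ∣ y ∣≤ b → ∣ x + y ∣≤ a + b
  ∣+∣≤ {a = a} {b} (l , u) (l′ , u′) =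
    ≤-respˡ-≈ (solve 2 (λ a b → :- a :+ :- b := :- (a :+ b)) refl a b) (+-mono-≤ l l′) , +-mono-≤ u u′

  ∣-∣≤ : ∀ {x a} → ∣ x ∣≤ a → ∣ - x ∣≤ a
  ∣-∣≤ {x} {a} (l , u) =
    ≤-by (x≤y⇒0≤y-x u) (solve 2 (λ x a → :- x :- :- a := a :- x) refl x a) ,
    ≤-by (x≤y⇒0≤y-x l) (solve 2 (λ x a → a :- :- x := x :- :- a) refl x a)

  0≤2x⇒0≤x : ∀ {x} → 0# ≤ x + x → 0# ≤ x
  0≤2x⇒0≤x {x} p x<0 = p (<-trans (<-respʳ-≈ (+-identityˡ x) (+-monoˡ-< x x<0)) x<0)

  -- A case distinction on signs is avoided by (x + a)(y + b) + (a - x)(b - y) = 2(xy + ab) and (x +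
  -- a)(b - y) + (a - x)(y + b) = 2(ab - xy), whose left sides are nonnegative.
  ∣*∣≤ : ∀ {x y a b} → ∣ x ∣≤ a → ∣ y ∣≤ b → ∣ x * y ∣≤ a * b
  ∣*∣≤ {x} {y} {a} {b} (lx , ux) (ly , uy) =
    0≤y-x⇒x≤y (0≤2x⇒0≤x (≤-respʳ-≈
      (solve 4 (λ x y a b → (x :- :- a) :* (y :- :- b) :+ (a :- x) :* (b :- y)
        := (x :* y :- :- (a :* b)) :+ (x :* y :- :- (a :* b))) refl x y a b)
      (+-nonneg (*-nonneg (x≤y⇒0≤y-x lx) (x≤y⇒0≤y-x ly)) (*-nonneg (x≤y⇒0≤y-x ux) (x≤y⇒0≤y-x uy))))) ,
    0≤y-x⇒x≤y (0≤2x⇒0≤x (≤-respʳ-≈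
      (solve 4 (λ x y a b → (x :- :- a) :* (b :- y) :+ (a :- x) :* (y :- :- b)
        := (a :* b :- x :* y) :+ (a :* b :- x :* y)) refl x y a b)
      (+-nonneg (*-nonneg (x≤y⇒0≤y-x lx) (x≤y⇒0≤y-x uy)) (*-nonneg (x≤y⇒0≤y-x ux) (x≤y⇒0≤y-x ly)))))

  0≤⇒∣∣≤ : ∀ {x} → 0# ≤ x → ∣ x ∣≤ x
  0≤⇒∣∣≤ {x} 0≤x = ≤-by (+-nonneg 0≤x 0≤x) (solve 1 (λ x → x :- :- x := x :+ x) refl x) , ≤-refl

  ∣∣≤⇒0≤ : ∀ {x a} → ∣ x ∣≤ a → 0# ≤ a
  ∣∣≤⇒0≤ {x} {a} (l , u) = 0≤2x⇒0≤x (≤-respʳ-≈ (solve 2 (λ x a → x :- :- a :+ (a :- x) := a :+ a) refl x a)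
    (+-nonneg (x≤y⇒0≤y-x l) (x≤y⇒0≤y-x u)))

  private variable
    a b : Level
    A   : Set a
    B   : Set b

  ∑-cong : ∀ (xs : List A) {f g : A → Carrier} → (∀ x → f x ≈ g x) → ∑ xs f ≈ ∑ xs g
  ∑-cong []       f≈g = refl
  ∑-cong (x ∷ xs) f≈g = +-cong (f≈g x) (∑-cong xs f≈g)

  ∑-0 : ∀ (xs : List A) {f : A → Carrier} → (∀ x → f x ≈ 0#) → ∑ xs f ≈ 0#
  ∑-0 []       f≈0 = refl
  ∑-0 (x ∷ xs) f≈0 = trans (+-cong (f≈0 x) (∑-0 xs f≈0)) (+-identityˡ 0#)

  ∑-+ : ∀ (xs : List A) (f g : A → Carrier) → ∑ xs (λ x → f x + g x) ≈ ∑ xs f + ∑ xs g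
  ∑-+ []       f g = sym (+-identityˡ 0#)
  ∑-+ (x ∷ xs) f g = trans (+-congˡ (∑-+ xs f g))
    (solve 4 (λ a b c d → a :+ b :+ (c :+ d) := a :+ c :+ (b :+ d)) refl _ _ _ _)

  ∑-*ˡ : ∀ (xs : List A) k (f : A → Carrier) → ∑ xs (λ x → k * f x) ≈ k * ∑ xs f
  ∑-*ˡ []       k f = sym (zeroʳ k)
  ∑-*ˡ (x ∷ xs) k f = trans (+-congˡ (∑-*ˡ xs k f)) (sym (distribˡ k _ _))

  ∑-*ʳ : ∀ (xs : List A) k (f : A → Carrier) → ∑ xs (λ x → f x * k) ≈ ∑ xs f * k
  ∑-*ʳ xs k f = trans (∑-cong xs λ x → *-comm (f x) k) (trans (∑-*ˡ xs k f) (*-comm k _))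

  ∑-- : ∀ (xs : List A) (f g : A → Carrier) → ∑ xs (λ x → f x - g x) ≈ ∑ xs f - ∑ xs g
  ∑-- []       f g = solve 0 (:0 := :0 :- :0) refl
  ∑-- (x ∷ xs) f g = trans (+-congˡ (∑-- xs f g))
    (solve 4 (λ a b c d → a :- b :+ (c :- d) := a :+ c :- (b :+ d)) refl _ _ _ _)

  ∣∑∣≤ : ∀ (xs : List A) {f g : A → Carrier} → (∀ x → ∣ f x ∣≤ g x) → ∣ ∑ xs f ∣≤ ∑ xs g
  ∣∑∣≤ []       p = ∣0∣≤ ≤-refl
  ∣∑∣≤ (x ∷ xs) p = ∣+∣≤ (p x) (∣∑∣≤ xs p)

  ∑-const : ∀ (xs : List A) k → ∑ xs (λ _ → k) ≈ fromℕ (length xs) * k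
  ∑-const []       k = sym (zeroˡ k)
  ∑-const (x ∷ xs) k = trans (+-congˡ (∑-const xs k))
    (solve 2 (λ k m → k :+ m :* k := (:1 :+ m) :* k) refl k (fromℕ (length xs)))

  ∑-swap : ∀ (xs : List A) (ys : List B) (f : A → B → Carrier) →
           ∑ xs (λ x → ∑ ys (f x)) ≈ ∑ ys (λ y → ∑ xs (λ x → f x y))
  ∑-swap []       ys f = sym (∑-0 ys λ _ → refl)
  ∑-swap (x ∷ xs) ys f = trans (+-congˡ (∑-swap xs ys f)) (sym (∑-+ ys (f x) _))

  𝟙-yes : ∀ (d : Dec A) → A → ∀ x → 𝟙 d * x ≈ x
  𝟙-yes (yes _) _ x = *-identityˡ x
  𝟙-yes (no ¬p) p x = contradiction p ¬p

  𝟙-no : ∀ (d : Dec A) → ¬ A → ∀ x → 𝟙 d * x ≈ 0#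
  𝟙-no (yes p) ¬p x = contradiction p ¬p
  𝟙-no (no _)  _  x = zeroˡ x

  module _ {p} {P : A → Set p} (P? : ∀ x → Dec (P x)) {f : A → Carrier} where

    private
      absent : ∀ {y} xs → All (y ≢_) xs → (∀ x → P x → y ≡ x) → ∑ xs (λ x → 𝟙 (P? x) * f x) ≈ 0#
      absent []       []         only = refl
      absent (x ∷ xs) (y≢x ∷ ps) only =
        trans (+-cong (𝟙-no (P? x) (λ p → y≢x (only x p)) (f x)) (absent xs ps only)) (+-identityˡ 0#)

    ∑-𝟙 : ∀ {xs} → Unique xs → ∀ {y} → y ∈ xs → P y → (∀ x → P x → y ≡ x) →
          ∑ xs (λ x → 𝟙 (P? x) * f x) ≈ f y
    ∑-𝟙 {x ∷ xs} (ps ∷ _)  (here ≡.refl) p only =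
      trans (+-cong (𝟙-yes (P? x) p (f x)) (absent xs ps only)) (+-identityʳ _)
    ∑-𝟙 {x ∷ xs} (ps ∷ xs!) {y} (there y∈xs) p only =
      trans (+-cong (𝟙-no (P? x) x≠y (f x)) (∑-𝟙 xs! y∈xs p only)) (+-identityˡ _)
      where
      x≠y : ¬ P x
      x≠y q = All.lookup ps y∈xs (≡.sym (only x q))

-- From intertwined generators to intertwined semigroups and path laws

module Intertwining {c ℓ₁ ℓ₂ ℓ₃} (ℝ : Reals c ℓ₁ ℓ₂ ℓ₃) {S : Set} (finite : Finite S) where

  open Reals ℝ using (orderedField; archimedean)
  open OrderedFieldProperties orderedField
  open Finite finite
  open SetoidReasoning setoid

  private variable
    f g : S → Carrier
    t h ε M : Carrier

  -- The maximum of finitely many thresholds works for every state; this is where finiteness of the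
  -- state space makes estimates uniform.
  uniform : ∀ {p} (P : S → ℕ → Set p) → (∀ s → ∃[ N ] (∀ i → N ℕ.≤ i → P s i)) →
            ∃[ N ] (∀ s i → N ℕ.≤ i → P s i)
  uniform P p = proj₁ (on elements) , λ s → proj₂ (on elements) s (enumeration s)
    where
    on : ∀ xs → ∃[ N ] (∀ s → s ∈ xs → ∀ i → N ℕ.≤ i → P s i)
    on []       = 0 , λ _ ()
    on (x ∷ xs) = proj₁ (p x) ℕ.⊔ proj₁ (on xs) , λ where
      s (here ≡.refl) i le → proj₂ (p x) i (ℕ.≤-trans (ℕ.m≤m⊔n _ _) le)
      s (there s∈xs)  i le → proj₂ (on xs) s s∈xs i (ℕ.≤-trans (ℕ.m≤n⊔m (proj₁ (p x)) _) le)

  bounded : ∀ (f : S → Carrier) → ∃[ M ] (0# ≤ M × (∀ s → ∣ f s ∣≤ M))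
  bounded f = fromℕ (proj₁ bound) , fromℕ-nonneg (proj₁ bound) , λ s → proj₂ bound s _ ℕ.≤-refl
    where
    at : ∀ s → ∃[ N ] (∀ i → N ℕ.≤ i → ∣ f s ∣≤ fromℕ i)
    at s with archimedean (f s) | archimedean (- f s)
    ... | j , f<j | k , -f<k = j ℕ.⊔ k , λ i le →
      ≤-by (x≤y⇒0≤y-x (<-weaken (<-≤-trans -f<k (fromℕ-mono {k} {i} (ℕ.≤-trans (ℕ.m≤n⊔m j k) le)))))
        (solve 2 (λ x i → x :- :- i := i :- :- x) refl (f s) (fromℕ i)) ,
      <-weaken (<-≤-trans f<j (fromℕ-mono {j} {i} (ℕ.≤-trans (ℕ.m≤m⊔n j k) le)))
    bound : ∃[ N ] (∀ s i → N ℕ.≤ i → ∣ f s ∣≤ fromℕ i)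
    bound = uniform (λ s i → ∣ f s ∣≤ fromℕ i) at

  -- Abstract because unfolding recip exposes the whole proof of fromℕ-pos.
  abstract
    reciprocal : ℕ → Carrier
    reciprocal N = recip (fromℕ (suc N)) (fromℕ-pos N)

    reciprocal-inverse : ∀ N → reciprocal N * fromℕ (suc N) ≈ 1#
    reciprocal-inverse N = recip-inverseˡ (fromℕ (suc N)) (fromℕ-pos N)

  reciprocal-pos : ∀ N → 0# < reciprocal N
  reciprocal-pos N = inverse-pos (fromℕ-pos N) (reciprocal-inverse N)

  cancel-reciprocal : ∀ x N → x * reciprocal N * fromℕ (suc N) ≈ x
  cancel-reciprocal x N =
    trans (*-assoc x _ _) (trans (*-congˡ (reciprocal-inverse N)) (*-identityʳ x))

  -- If 0 < x, choose a natural number k above D; then ε = x / (k + 1) satisfies ε D < x.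
  arbitrarily-small⇒≤0 : ∀ {x D} → (∀ {ε} → 0# < ε → x ≤ ε * D) → x ≤ 0#
  arbitrarily-small⇒≤0 {x} {D} small 0<x with archimedean D
  ... | k , D<k = small 0<δ (<-respˡ-≈ (*-comm D δ) (<-respʳ-≈ Dδ (*-monoˡ-< 0<δ D<k+1)))
    where
    δ = x * reciprocal k
    0<δ : 0# < δ
    0<δ = *-pos 0<x (reciprocal-pos k)
    D<k+1 : D < fromℕ (suc k)
    D<k+1 = <-≤-trans D<k (fromℕ-mono {k} (ℕ.n≤1+n k))
    Dδ : fromℕ (suc k) * δ ≈ x
    Dδ = trans (*-comm _ δ) (cancel-reciprocal x k)

  arbitrarily-small⇒≈0 : ∀ {x D} → (∀ {ε} → 0# < ε → ∣ x ∣≤ ε * D) → x ≈ 0#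
  arbitrarily-small⇒≈0 {x} {D} small = ≤-antisym
    (arbitrarily-small⇒≤0 λ 0<ε → proj₂ (small 0<ε))
    (≤-by (x≤y⇒0≤y-x (arbitrarily-small⇒≤0 λ 0<ε → proj₂ (∣-∣≤ (small 0<ε))))
      (solve 1 (λ x → x :- :0 := :0 :- :- x) refl x))

  -- The mesh when [0, t] is divided into N + 1 equal pieces.
  step : Carrier → ℕ → Carrier
  step t N = t * reciprocal N

  step-pos : ∀ {t} → 0# < t → ∀ N → 0# < step t N
  step-pos 0<t N = *-pos 0<t (reciprocal-pos N)

  step-small : ∀ t {δ} → 0# < δ → ∃[ N₀ ] (∀ N → N₀ ℕ.≤ N → step t N < δ)
  step-small t {δ} 0<δ with archimedean (t * recip δ 0<δ)
  ... | k , t/δ<k = k , λ N k≤N →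
    <-respˡ-≈ (*-congʳ (trans (*-assoc t _ δ) (trans (*-congˡ (recip-inverseˡ δ 0<δ)) (*-identityʳ t))))
      (<-respʳ-≈ (trans (solve 3 (λ k δ r → k :* δ :* r := δ :* r :* k) refl _ δ _) (cancel-reciprocal δ N))
        (*-monoˡ-< (reciprocal-pos N) (*-monoˡ-< 0<δ
          (<-≤-trans t/δ<k (fromℕ-mono {k} (ℕ.≤-trans k≤N (ℕ.n≤1+n N)))))))

  -- The difference form stands for the rate matrix whose diagonal is chosen so that its rows sum to
  -- zero.
  generator : (S → S → Carrier) → (S → Carrier) → S → Carrier
  generator q f η = ∑ elements λ ζ → q η ζ * (f ζ - f η)

  module Semigroup {q : S → S → Carrier} (W : JumpProcess ℝ finite q) where

    open JumpProcess W

    P : Carrier → (S → Carrier) → S → Carrier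
    P t f η = ∑ elements λ ζ → transition t η ζ * f ζ

    P-cong : (∀ s → f s ≈ g s) → ∀ η → P t f η ≈ P t g η
    P-cong f≈g η = ∑-cong elements λ ζ → *-congˡ (f≈g ζ)

    P-time-cong : ∀ {u} → 0# ≤ t → t ≈ u → ∀ η → P t f η ≈ P u f η
    P-time-cong 0≤t t≈u η = ∑-cong elements λ ζ → *-congʳ (transition-cong 0≤t t≈u η ζ)

    P-- : ∀ η → P t (λ ζ → f ζ - g ζ) η ≈ P t f η - P t g η
    P-- η = trans (∑-cong elements λ ζ → solve 3 (λ p a b → p :* (a :- b) := p :* a :- p :* b) refl _ _ _)
      (∑-- elements _ _)

    P-contraction : 0# ≤ t → (∀ s → ∣ f s ∣≤ M) → ∀ η → ∣ P t f η ∣≤ M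
    P-contraction {M = M} 0≤t f≤M η = ∣∣≤-cong refl
      (trans (∑-*ʳ elements M _) (trans (*-congʳ (total 0≤t η)) (*-identityˡ M)))
      (∣∑∣≤ elements λ ζ → ∣*∣≤ (0≤⇒∣∣≤ (nonnegative 0≤t η ζ)) (f≤M ζ))

    P-0 : ∀ η → P 0# f η ≈ f η
    P-0 {f} η = trans (∑-cong elements λ ζ → *-congʳ (initial η ζ))
      (∑-𝟙 (η ≟_) {f} unique (enumeration η) ≡.refl (λ _ η≡ζ → η≡ζ))

    P-+ : ∀ {t u} → 0# ≤ t → 0# ≤ u → ∀ η → P (t + u) f η ≈ P t (P u f) η
    P-+ {f} {t} {u} 0≤t 0≤u η = begin
      ∑ elements (λ ζ → transition (t + u) η ζ * f ζ)
        ≈⟨ ∑-cong elements (λ ζ → trans (*-congʳ (chapmanKolmogorov 0≤t 0≤u η ζ)) (sym (∑-*ʳ elements (f ζ) _))) ⟩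
      ∑ elements (λ ζ → ∑ elements λ ξ → transition t η ξ * transition u ξ ζ * f ζ)
        ≈⟨ ∑-swap elements elements _ ⟩
      ∑ elements (λ ξ → ∑ elements λ ζ → transition t η ξ * transition u ξ ζ * f ζ)
        ≈⟨ ∑-cong elements (λ ξ → trans (∑-cong elements λ ζ → *-assoc _ _ _) (∑-*ˡ elements _ _)) ⟩
      ∑ elements (λ ξ → transition t η ξ * P u f ξ) ∎

    Linearised : Carrier → Carrier → Set _
    Linearised ε h = ∀ {η ζ} → η ≢ ζ → ∣ transition h η ζ - h * q η ζ ∣≤ ε * h

    eventually-linearised : 0# < t → 0# < ε → ∃[ N₀ ] (∀ N → N₀ ℕ.≤ N → Linearised ε (step t N))
    eventually-linearised {t} {ε} 0<t 0<ε = proj₁ all , λ N le {η} {ζ} → proj₂ all η N le ζ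
      where
      Error : S → S → ℕ → Set _
      Error η ζ N = η ≢ ζ → ∣ transition (step t N) η ζ - step t N * q η ζ ∣≤ ε * step t N

      at : ∀ η ζ → ∃[ N₀ ] (∀ N → N₀ ℕ.≤ N → Error η ζ N)
      at η ζ with η ≟ ζ
      ... | yes η≡ζ = 0 , λ _ _ η≢ζ → contradiction η≡ζ η≢ζ
      ... | no  η≢ζ = proj₁ small , λ N le _ → proj₂ (proj₂ δ) (step-pos 0<t N) (proj₂ small N le)
        where
        δ     = jumpRate η≢ζ 0<ε
        small = step-small t (proj₁ (proj₂ δ))

      row : ∀ η → ∃[ N₀ ] (∀ N → N₀ ℕ.≤ N → ∀ ζ → Error η ζ N)
      row η = proj₁ N₀ , λ N le ζ → proj₂ N₀ ζ N le
        where
        N₀ = uniform (Error η) (at η)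

      all : ∃[ N₀ ] (∀ η N → N₀ ℕ.≤ N → ∀ ζ → Error η ζ N)
      all = uniform (λ η N → ∀ ζ → Error η ζ N) row

    -- Because transition probabilities sum to 1, the remainder equals Σ (p ζ - h q η ζ)(f ζ - f η).
    -- Its diagonal term is zero, so off-diagonal jump rates suffice to estimate it.
    P-expansion : 0# < h → 0# < ε → Linearised ε h → 0# ≤ M → (∀ s → ∣ f s ∣≤ M) → ∀ η →
      ∣ P h f η - f η - h * generator q f η ∣≤ fromℕ (length elements) * (ε * h * (M + M))
    P-expansion {h} {ε} {M} {f} 0<h 0<ε linearised 0≤M f≤M η =
      ∣∣≤-cong expand (∑-const elements _) (∣∑∣≤ elements term)
      where
      p = transition h η

      term : ∀ ζ → ∣ (p ζ - h * q η ζ) * (f ζ - f η) ∣≤ ε * h * (M + M)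
      term ζ with η ≟ ζ
      ... | yes ≡.refl = ∣∣≤-congˡ (solve 2 (λ a b → :0 := a :* (b :- b)) refl (p η - h * q η η) (f η))
        (∣0∣≤ (*-nonneg (<-weaken (*-pos 0<ε 0<h)) (+-nonneg 0≤M 0≤M)))
      ... | no η≢ζ = ∣*∣≤ (linearised η≢ζ) (∣+∣≤ (f≤M ζ) (∣-∣≤ (f≤M η)))

      expand : ∑ elements (λ ζ → (p ζ - h * q η ζ) * (f ζ - f η)) ≈ P h f η - f η - h * generator q f η
      expand = begin
        ∑ elements (λ ζ → (p ζ - h * q η ζ) * (f ζ - f η))
          ≈⟨ ∑-cong elements (λ ζ → solve 5 (λ p h q x y → (p :- h :* q) :* (x :- y)
               := p :* x :- p :* y :- h :* (q :* (x :- y))) refl (p ζ) h (q η ζ) (f ζ) (f η)) ⟩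
        ∑ elements (λ ζ → p ζ * f ζ - p ζ * f η - h * (q η ζ * (f ζ - f η)))
          ≈⟨ ∑-- elements _ _ ⟩
        ∑ elements (λ ζ → p ζ * f ζ - p ζ * f η) - ∑ elements (λ ζ → h * (q η ζ * (f ζ - f η)))
          ≈⟨ +-cong (∑-- elements _ _) (-‿cong (∑-*ˡ elements h _)) ⟩
        P h f η - ∑ elements (λ ζ → p ζ * f η) - h * generator q f η
          ≈⟨ +-congʳ (+-congˡ (-‿cong (trans (∑-*ʳ elements (f η) p)
               (trans (*-congʳ (total (<-weaken 0<h) η)) (*-identityˡ (f η)))))) ⟩
        P h f η - f η - h * generator q f η ∎

  -- Neither positivity nor contraction is demanded, as the kernels are signed. Any fixed `norm`
  -- will do: it enters the error as a constant factor and is multiplicative under composition.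
  record BoundedLinear (K : (S → Carrier) → S → Carrier) : Set (c ⊔ ℓ₁ ⊔ ℓ₃) where
    field
      cong       : (∀ s → f s ≈ g s) → ∀ s → K f s ≈ K g s
      linear     : ∀ f k g s → K (λ s → f s + k * g s) s ≈ K f s + k * K g s
      norm       : Carrier
      0≤norm     : 0# ≤ norm
      norm-bound : (∀ s → ∣ f s ∣≤ M) → ∀ s → ∣ K f s ∣≤ norm * M

  module _ {q q′ : S → S → Carrier} (W : JumpProcess ℝ finite q) (W′ : JumpProcess ℝ finite q′)
           {K : (S → Carrier) → S → Carrier} (bl : BoundedLinear K)
           (intertwines : ∀ f η → generator q (K f) η ≈ K (generator q′ f) η) where

    open BoundedLinear bl
    private
      open module W  = Semigroup W  using (P)
      open module W′ = Semigroup W′ using () renaming (P to P′)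

      -- Two applications of `P-expansion`: one to K f, which is bounded by norm · M, and one to f,
      -- whose remainder is then transported by K.
      error : Carrier → Carrier
      error M = fromℕ (length elements) * (norm * M + norm * M) + norm * (fromℕ (length elements) * (M + M))

      one-step : 0# < h → 0# < ε → W.Linearised ε h → W′.Linearised ε h → (∀ s → ∣ f s ∣≤ M) →
                 ∀ η → ∣ P h (K f) η - K (P′ h f) η ∣≤ ε * h * error M
      one-step {h} {ε} {f} {M} 0<h 0<ε lin lin′ f≤M η = ∣∣≤-cong
        (begin
          (P h (K f) η - K f η - h * generator q (K f) η) - K e η
            ≈⟨ +-cong (+-congˡ (-‿cong (*-congˡ (intertwines f η)))) (-‿cong Ke) ⟩
          (P h (K f) η - K f η - h * K (generator q′ f) η) - (K (P′ h f) η - K f η - h * K (generator q′ f) η)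
            ≈⟨ solve 5 (λ a b h c d → (a :- b :- h :* c) :- (d :- b :- h :* c) := a :- d) refl _ _ h _ _ ⟩
          P h (K f) η - K (P′ h f) η ∎)
        (solve 5 (λ n ε h m k → n :* (ε :* h :* (k :* m :+ k :* m)) :+ k :* (n :* (ε :* h :* (m :+ m)))
          := ε :* h :* (n :* (k :* m :+ k :* m) :+ k :* (n :* (m :+ m)))) refl (fromℕ (length elements)) ε h M norm)
        (∣+∣≤ (W.P-expansion 0<h 0<ε lin (*-nonneg 0≤norm 0≤M) (norm-bound f≤M) η)
              (∣-∣≤ (norm-bound (W′.P-expansion 0<h 0<ε lin′ 0≤M f≤M) η)))
        where
        0≤M = ∣∣≤⇒0≤ (f≤M η)
        e : S → Carrier
        e ζ = P′ h f ζ - f ζ - h * generator q′ f ζ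
        Ke : K e η ≈ K (P′ h f) η - K f η - h * K (generator q′ f) η
        Ke = begin
          K e η
            ≈⟨ cong (λ ζ → solve 4 (λ a b h c → a :- b :- h :* c := a :+ (:- :1) :* b :+ (:- h) :* c) refl _ _ h _) η ⟩
          K (λ ζ → P′ h f ζ + (- 1#) * f ζ + (- h) * generator q′ f ζ) η
            ≈⟨ linear _ (- h) _ η ⟩
          K (λ ζ → P′ h f ζ + (- 1#) * f ζ) η + (- h) * K (generator q′ f) η
            ≈⟨ +-congʳ (linear _ (- 1#) _ η) ⟩
          K (P′ h f) η + (- 1#) * K f η + (- h) * K (generator q′ f) η
            ≈⟨ solve 4 (λ a b h c → a :+ (:- :1) :* b :+ (:- h) :* c := a :- b :- h :* c) refl _ _ h _ ⟩
          K (P′ h f) η - K f η - h * K (generator q′ f) η ∎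

      -- Repeated addition makes the semigroup law `P-+` match the recursion; `times≈` and
      -- `P-time-cong` lead back to the given time.
      times : Carrier → ℕ → Carrier
      times h zero    = 0#
      times h (suc m) = h + times h m

      times-nonneg : 0# < h → ∀ m → 0# ≤ times h m
      times-nonneg 0<h zero    = ≤-refl
      times-nonneg 0<h (suc m) = +-nonneg (<-weaken 0<h) (times-nonneg 0<h m)

      times≈ : ∀ h m → times h m ≈ h * fromℕ m
      times≈ h zero    = sym (zeroʳ h)
      times≈ h (suc m) = trans (+-congˡ (times≈ h m))
        (solve 2 (λ h m → h :+ h :* m := h :* (:1 :+ m)) refl h (fromℕ m))

      -- Telescoping with u = m h: P_{h+u} K - K P′_{h+u} = (P_h K - K P′_h) P′_u + P_h (P_u K - K
      -- P′_u). Contractivity of P′_u controls the first summand and that of P_h the second, so the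
      -- step errors add up without amplification.
      many-steps : 0# < h → 0# < ε → W.Linearised ε h → W′.Linearised ε h → (∀ s → ∣ f s ∣≤ M) →
        ∀ m η → ∣ P (times h m) (K f) η - K (P′ (times h m) f) η ∣≤ fromℕ m * (ε * h * error M)
      many-steps {h} {ε} {f} {M} 0<h 0<ε lin lin′ f≤M zero η = ∣∣≤-cong
        (sym (trans (+-cong (W.P-0 η) (-‿cong (cong (λ ζ → W′.P-0 ζ) η))) (-‿inverseʳ _)))
        (sym (zeroˡ _)) (∣0∣≤ ≤-refl)
      many-steps {h} {ε} {f} {M} 0<h 0<ε lin lin′ f≤M (suc m) η = ∣∣≤-cong
        (begin
          (P h (K f′) η - K (P′ h f′) η) + P h (λ ζ → P u (K f) ζ - K f′ ζ) η
            ≈⟨ +-congˡ (W.P-- η) ⟩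
          (P h (K f′) η - K (P′ h f′) η) + (P h (P u (K f)) η - P h (K f′) η)
            ≈⟨ solve 3 (λ a b c → a :- b :+ (c :- a) := c :- b) refl _ _ _ ⟩
          P h (P u (K f)) η - K (P′ h f′) η
            ≈⟨ +-cong (W.P-+ (<-weaken 0<h) (times-nonneg 0<h m) η)
                 (-‿cong (cong (W′.P-+ (<-weaken 0<h) (times-nonneg 0<h m)) η)) ⟨
          P (h + u) (K f) η - K (P′ (h + u) f) η ∎)
        (solve 2 (λ e m → e :+ m :* e := (:1 :+ m) :* e) refl _ (fromℕ m))
        (∣+∣≤ (one-step 0<h 0<ε lin lin′ (W′.P-contraction (times-nonneg 0<h m) f≤M) η)
              (W.P-contraction (<-weaken 0<h) (many-steps 0<h 0<ε lin lin′ f≤M m) η))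
        where
        u = times h m
        f′ = P′ u f

    semigroup-intertwines : 0# < t → ∀ (f : S → Carrier) η → P t (K f) η ≈ K (P′ t f) η
    semigroup-intertwines {t} 0<t f η = begin
      P t (K f) η                               ≈⟨ solve 2 (λ a b → a := a :- b :+ b) refl _ _ ⟩
      P t (K f) η - K (P′ t f) η + K (P′ t f) η ≈⟨ +-congʳ (arbitrarily-small⇒≈0 small) ⟩
      0# + K (P′ t f) η                         ≈⟨ +-identityˡ _ ⟩
      K (P′ t f) η                              ∎
      where
      bound = bounded f

      -- The N + 1 steps of length t / (N + 1) contribute ε · t · `error` in total. The factor after
      -- ε is independent of ε, while N is taken large enough for both linearisations at this ε.
      small : 0# < ε → ∣ P t (K f) η - K (P′ t f) η ∣≤ ε * (t * error (proj₁ bound))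
      small {ε} 0<ε = ∣∣≤-cong
        (+-cong (W.P-time-cong 0≤T T≈t η) (-‿cong (cong (W′.P-time-cong 0≤T T≈t) η)))
        (trans (solve 4 (λ n ε h e → n :* (ε :* h :* e) := ε :* (h :* n :* e)) refl _ ε h₀ _)
          (*-congˡ (*-congʳ (cancel-reciprocal t N))))
        (many-steps (step-pos 0<t N) 0<ε
          (proj₂ W-lin N (ℕ.m≤m⊔n _ _)) (proj₂ W′-lin N (ℕ.m≤n⊔m (proj₁ W-lin) _)) (proj₂ (proj₂ bound)) (suc N) η)
        where
        W-lin  = W.eventually-linearised 0<t 0<ε
        W′-lin = W′.eventually-linearised 0<t 0<ε
        N = proj₁ W-lin ℕ.⊔ proj₁ W′-lin
        h₀ = step t N
        0≤T : 0# ≤ times h₀ (suc N)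
        0≤T = times-nonneg (step-pos 0<t N) (suc N)
        T≈t : times h₀ (suc N) ≈ t
        T≈t = trans (times≈ h₀ (suc N)) (cancel-reciprocal t N)

    module _ {C : Set} (_≟C_ : DecidableEquality C) (obs : S → C)
             (K-obs : ∀ (v : C → Carrier) f η → K (λ ζ → v (obs ζ) * f ζ) η ≈ v (obs η) * K f η)
             (K-1 : ∀ η → K (λ _ → 1#) η ≈ 1#) where

      private
        cyl  = cylinderProbability ℝ finite _≟C_ obs W
        cyl′ = cylinderProbability ℝ finite _≟C_ obs W′

      -- Induction from the last observation backwards: `K-obs` moves the indicator of the observed
      -- value inside K, and the semigroup of the preceding time interval then passes through K. The
      -- empty list of observations is K 1 = 1.
      cylinder-intertwines : ∀ es → Linked _<_ (t ∷ map proj₁ es) → ∀ η →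
                             cyl t η es ≈ K (λ ζ → cyl′ t ζ es) η
      cylinder-intertwines []             _              η = sym (K-1 η)
      cylinder-intertwines {t} ((u , x) ∷ es) (t<u ∷ increasing) η = begin
        ∑ elements (λ ζ → χ (obs ζ) * (p ζ * cyl u ζ es))
          ≈⟨ ∑-cong elements (λ ζ → solve 3 (λ a b c → a :* (b :* c) := b :* (a :* c)) refl _ _ _) ⟩
        P (u - t) (λ ζ → χ (obs ζ) * cyl u ζ es) η
          ≈⟨ W.P-cong (λ ζ → *-congˡ (cylinder-intertwines es increasing ζ)) η ⟩
        P (u - t) (λ ζ → χ (obs ζ) * K (λ ξ → cyl′ u ξ es) ζ) η
          ≈⟨ W.P-cong (λ ζ → K-obs χ _ ζ) η ⟨
        P (u - t) (K λ ζ → χ (obs ζ) * cyl′ u ζ es) η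
          ≈⟨ semigroup-intertwines (x<y⇒0<y-x t<u) _ η ⟩
        K (P′ (u - t) λ ζ → χ (obs ζ) * cyl′ u ζ es) η
          ≈⟨ cong (λ ζ → ∑-cong elements λ ξ → solve 3 (λ a b c → b :* (a :* c) := a :* (b :* c)) refl _ _ _) η ⟩
        K (λ ζ → cyl′ t ζ ((u , x) ∷ es)) η ∎
        where
        χ = λ y → 𝟙 (y ≟C x)
        p = JumpProcess.transition W (u - t) η

-- Multisets of species and induction along the strongest particle

module _ {s : ℕ} where

  insert remove : Fin s → Multiset s → Multiset s
  insert i = _[ i ]%= suc
  remove i = _[ i ]%= ℕ.pred

  infix 4 _⊴_
  -- Says that `i` dominates every species present in `m`. Wrapped in a record so that `m` and `i`
  -- can be inferred from a proof.
  record _⊴_ (m : Multiset s) (i : Fin s) : Set where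
    constructor absent
    field above : ∀ k → toℕ i ℕ.< toℕ k → lookup m k ≡ 0

  open _⊴_ public

  lookup-⊎ₘ : ∀ (m m′ : Multiset s) k → lookup (m ⊎ₘ m′) k ≡ lookup m k ℕ.+ lookup m′ k
  lookup-⊎ₘ m m′ k = Vec.lookup-zipWith ℕ._+_ k m m′

  ∅-⊴ : ∀ i → ∅ ⊴ i
  ∅-⊴ i .above k _ = Vec.lookup-replicate k 0

  ⊴-⊎ₘˡ : ∀ {m i} m′ → m ⊎ₘ m′ ⊴ i → m ⊴ i
  ⊴-⊎ₘˡ {m} m′ p .above k i<k =
    ℕ.m+n≡0⇒m≡0 (lookup m k) (≡.trans (≡.sym (lookup-⊎ₘ m m′ k)) (above p k i<k))

  ⊎ₘ-⊴ : ∀ {m m′ i} → m ⊴ i → m′ ⊴ i → m ⊎ₘ m′ ⊴ i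
  ⊎ₘ-⊴ {m} {m′} p p′ .above k i<k =
    ≡.trans (lookup-⊎ₘ m m′ k) (≡.cong₂ ℕ._+_ (above p k i<k) (above p′ k i<k))

  ⊴-trans : ∀ {m i j} → m ⊴ i → toℕ i ℕ.≤ toℕ j → m ⊴ j
  ⊴-trans p i≤j .above k j<k = above p k (ℕ.≤-<-trans i≤j j<k)

  insert-⊴ : ∀ {m i j} → m ⊴ j → toℕ i ℕ.≤ toℕ j → insert i m ⊴ j
  insert-⊴ {m} {i} p i≤j .above k j<k =
    ≡.trans (Vec.lookup∘updateAt′ k i (λ { ≡.refl → ℕ.<⇒≱ j<k i≤j }) m) (above p k j<k)

  insert-⊴⁻¹ : ∀ {m i j} → insert i m ⊴ j → m ⊴ j × toℕ i ℕ.≤ toℕ j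
  insert-⊴⁻¹ {m} {i} {j} p = absent m⊴j , ℕ.≮⇒≥ λ j<i →
    contradiction (≡.trans (≡.sym (Vec.lookup∘updateAt i m)) (above p i j<i)) λ ()
    where
    m⊴j : ∀ k → toℕ j ℕ.< toℕ k → lookup m k ≡ 0
    m⊴j k j<k with k Fin.≟ i
    ... | yes ≡.refl = contradiction (≡.trans (≡.sym (Vec.lookup∘updateAt i m)) (above p i j<k)) λ ()
    ... | no  k≢i    = ≡.trans (≡.sym (Vec.lookup∘updateAt′ k i k≢i m)) (above p k j<k)

⊴-zero : ∀ {s k} {m : Multiset s} → k ∷ m ⊴ zero → ∀ j → lookup m j ≡ 0
⊴-zero p j = above p (suc j) (ℕ.s≤s ℕ.z≤n)

⊴-suc : ∀ {s k} {m : Multiset s} {i} → k ∷ m ⊴ suc i → m ⊴ i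
⊴-suc p .above j i<j = above p (suc j) (ℕ.s≤s i<j)

insert-comm : ∀ {s} (i j : Fin s) m → insert i (insert j m) ≡ insert j (insert i m)
insert-comm zero    zero    (k ∷ m) = ≡.refl
insert-comm zero    (suc j) (k ∷ m) = ≡.refl
insert-comm (suc i) zero    (k ∷ m) = ≡.refl
insert-comm (suc i) (suc j) (k ∷ m) = ≡.cong (k ∷_) (insert-comm i j m)

remove-insert : ∀ {s} (i : Fin s) m → remove i (insert i m) ≡ m
remove-insert zero    (k ∷ m) = ≡.refl
remove-insert (suc i) (k ∷ m) = ≡.cong (k ∷_) (remove-insert i m)

insert-⊎ₘˡ : ∀ {s} (i : Fin s) m m′ → insert i m ⊎ₘ m′ ≡ insert i (m ⊎ₘ m′)
insert-⊎ₘˡ zero    (k ∷ m) (k′ ∷ m′) = ≡.refl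
insert-⊎ₘˡ (suc i) (k ∷ m) (k′ ∷ m′) = ≡.cong (_ ∷_) (insert-⊎ₘˡ i m m′)

insert-⊎ₘʳ : ∀ {s} (i : Fin s) m m′ → m ⊎ₘ insert i m′ ≡ insert i (m ⊎ₘ m′)
insert-⊎ₘʳ zero    (k ∷ m) (k′ ∷ m′) = ≡.cong (_∷ (m ⊎ₘ m′)) (ℕ.+-suc k k′)
insert-⊎ₘʳ (suc i) (k ∷ m) (k′ ∷ m′) = ≡.cong (_ ∷_) (insert-⊎ₘʳ i m m′)

⊎ₘ-identityʳ : ∀ {s} (m : Multiset s) → m ⊎ₘ ∅ ≡ m
⊎ₘ-identityʳ = Vec.zipWith-identityʳ ℕ.+-identityʳ

strongest-zero : ∀ {s} (m : Multiset s) → (∀ k → lookup m k ≡ 0) → strongest m ≡ nothing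
strongest-zero []       p = ≡.refl
strongest-zero (x ∷ m)  p with p zero
... | ≡.refl rewrite strongest-zero m (p ∘ suc) = ≡.refl

strongest-∅ : ∀ {s} → strongest (∅ {s}) ≡ nothing
strongest-∅ = strongest-zero ∅ λ k → Vec.lookup-replicate k 0

strongest-insert : ∀ {s} (i : Fin s) {m} → m ⊴ i → strongest (insert i m) ≡ just i
strongest-insert zero    {k ∷ m}     p rewrite strongest-zero m (⊴-zero p) = ≡.refl
strongest-insert (suc i) {zero ∷ m}  p rewrite strongest-insert i {m} (⊴-suc p) = ≡.refl
strongest-insert (suc i) {suc _ ∷ m} p rewrite strongest-insert i {m} (⊴-suc p) = ≡.refl

-- A view: every multiset arises by inserting species in weakly increasing order. The outermost
-- `add` therefore exposes the strongest particle, which is the one that `strongest` finds and that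
-- `scatter` treats next.
data Sorted {s : ℕ} : Multiset s → Set where
  []  : Sorted ∅
  add : ∀ {m} i → m ⊴ i → Sorted m → Sorted (insert i m)

sorted : ∀ {s} (m : Multiset s) → Sorted m
sorted []      = []
sorted (k ∷ m) = weaker k (sorted m)
  where
  -- Label zero is the weakest, so its k copies have to be inserted innermost, before any particle
  -- of `m`.
  weaker : ∀ {s} {m : Multiset s} k → Sorted m → Sorted (k ∷ m)
  weaker zero    []            = []
  weaker (suc k) []            = add zero (absent λ { (suc j) _ → Vec.lookup-replicate j 0 }) (weaker k [])
  weaker k       (add i m⊴i p) = add (suc i) (absent λ { (suc j) (ℕ.s≤s lt) → above m⊴i j lt }) (weaker k p)

descending : ∀ {s} → Multiset s → List (Fin s)
descending []      = []
descending (k ∷ m) = List.map suc (descending m) ++ List.replicate k zero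

descending-zero : ∀ {s} (m : Multiset s) → (∀ k → lookup m k ≡ 0) → descending m ≡ []
descending-zero []      p = ≡.refl
descending-zero (x ∷ m) p with p zero
... | ≡.refl rewrite descending-zero m (p ∘ suc) = ≡.refl

descending-∅ : ∀ {s} → descending (∅ {s}) ≡ []
descending-∅ = descending-zero ∅ λ k → Vec.lookup-replicate k 0

descending-insert : ∀ {s} (i : Fin s) {m} → m ⊴ i → descending (insert i m) ≡ i ∷ descending m
descending-insert zero    {k ∷ m} p rewrite descending-zero m (⊴-zero p) = ≡.refl
descending-insert (suc i) {k ∷ m} p rewrite descending-insert i {m} (⊴-suc p) = ≡.refl

collect : ∀ {s} → List (Fin s) → Multiset s
collect = List.foldr insert ∅

collect-descending : ∀ {s} (m : Multiset s) → collect (descending m) ≡ m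
collect-descending m = go (sorted m)
  where
  go : ∀ {s} {m : Multiset s} → Sorted m → collect (descending m) ≡ m
  go []            = ≡.cong collect descending-∅
  go (add i m⊴i p) = ≡.trans (≡.cong collect (descending-insert i m⊴i)) (≡.cong (insert i) (go p))

-- The two-site kernel and its exchange identity

module Swapping {c ℓ₁ ℓ₂ ℓ₃} (F : OrderedField c ℓ₁ ℓ₂ ℓ₃) {s : ℕ} (ρ : OrderedField.Carrier F) where

  open OrderedFieldProperties F
  open SetoidReasoning setoid

  Observable : Set c
  Observable = Multiset s → Multiset s → Carrier

  private variable
    φ χ : Observable
    A B : Multiset s
    M : Carrier

  raise : Fin s → Observable → Observable
  raise i φ A B = φ A (insert i B)

  -- With weight 1 − ρ all of i ∷ is goes to the first component; with weight ρ the
  -- strongest particle i stays in the second one, and the others are scattered in turn.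
  scatter : Multiset s → List (Fin s) → Observable → Carrier
  scatter A []       φ = φ A ∅
  scatter A (i ∷ is) φ = (1# - ρ) * φ (A ⊎ₘ collect (i ∷ is)) ∅ + ρ * scatter A is (raise i φ)

  -- The weight 1 - ρ may be negative, so its absolute value is estimated by 1 + ρ.
  scatterNorm : List (Fin s) → Carrier
  scatterNorm []       = 1#
  scatterNorm (i ∷ is) = 1# + ρ + ρ * scatterNorm is

  abstract
    κ : Observable → Observable
    κ φ A B = scatter A (descending B) φ

    κ-∅ : ∀ φ A → κ φ A ∅ ≡ φ A ∅
    κ-∅ φ A rewrite descending-∅ {s} = ≡.refl

    κ-insert : ∀ φ A {i B} → B ⊴ i →
      κ φ A (insert i B) ≡ (1# - ρ) * φ (A ⊎ₘ insert i B) ∅ + ρ * κ (raise i φ) A B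
    κ-insert φ A {i} {B} B⊴i rewrite descending-insert i B⊴i | collect-descending B = ≡.refl

    κ-linear : ∀ φ k χ A B → κ (λ A B → φ A B + k * χ A B) A B ≈ κ φ A B + k * κ χ A B
    κ-linear φ k χ A B = go φ χ (descending B)
      where
      go : ∀ φ χ is → scatter A is (λ A B → φ A B + k * χ A B) ≈ scatter A is φ + k * scatter A is χ
      go φ χ []       = refl
      go φ χ (i ∷ is) = trans (+-congˡ (*-congˡ (go (raise i φ) (raise i χ) is)))
        (solve 6 (λ ρ k x y u v → (:1 :- ρ) :* (x :+ k :* y) :+ ρ :* (u :+ k :* v)
          := (:1 :- ρ) :* x :+ ρ :* u :+ k :* ((:1 :- ρ) :* y :+ ρ :* v)) refl ρ k _ _ _ _)

    κ-const : ∀ k A B → κ (λ _ _ → k) A B ≈ k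
    κ-const k A B = go (descending B)
      where
      go : ∀ is → scatter A is (λ _ _ → k) ≈ k
      go []       = refl
      go (i ∷ is) = trans (+-congˡ (*-congˡ (go is)))
        (solve 2 (λ ρ k → (:1 :- ρ) :* k :+ ρ :* k := k) refl ρ k)

    -- The kernel never takes particles away from the first site and its weights depend on `B`
    -- alone, so an additional particle there is merely carried along.
    κ-shift : ∀ m → κ φ (insert m A) B ≈ κ (λ A B → φ (insert m A) B) A B
    κ-shift {φ} {A} {B} m = go φ (descending B)
      where
      go : ∀ φ is → scatter (insert m A) is φ ≈ scatter A is (λ A B → φ (insert m A) B)
      go φ []       = refl
      go φ (i ∷ is) = +-cong
        (reflexive (≡.cong (λ A → (1# - ρ) * φ A ∅) (insert-⊎ₘˡ m A (collect (i ∷ is)))))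
        (*-congˡ (go (raise i φ) is))

    κ-bound : 0# ≤ ρ → (∀ A B → ∣ φ A B ∣≤ M) → ∣ κ φ A B ∣≤ scatterNorm (descending B) * M
    κ-bound {φ} {M} {A} {B} 0≤ρ φ≤M = go φ≤M (descending B)
      where
      ∣ρ∣≤ : ∣ ρ ∣≤ ρ
      ∣ρ∣≤ = 0≤⇒∣∣≤ 0≤ρ
      go : ∀ {φ} → (∀ A B → ∣ φ A B ∣≤ M) → ∀ is → ∣ scatter A is φ ∣≤ scatterNorm is * M
      go φ≤M []       = ∣∣≤-cong refl (sym (*-identityˡ M)) (φ≤M A ∅)
      go φ≤M (i ∷ is) = ∣∣≤-cong refl
        (solve 3 (λ ρ n m → (:1 :+ ρ) :* m :+ ρ :* (n :* m) := (:1 :+ ρ :+ ρ :* n) :* m) refl ρ (scatterNorm is) M)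
        (∣+∣≤ (∣*∣≤ (∣+∣≤ (0≤⇒∣∣≤ (<-weaken 0<1)) (∣-∣≤ ∣ρ∣≤)) (φ≤M _ ∅))
              (∣*∣≤ ∣ρ∣≤ (go (λ A B → φ≤M A (insert i B)) is)))

  -- Locality: `κ` evaluates its observable only at redistributions of A and B whose second
  -- component obeys every bound on B. Equality of the unions keeps the content fixed and bounds A′;
  -- the bound on B′ identifies its top particle after an insertion.
  κ-cong : (∀ A′ B′ → A′ ⊎ₘ B′ ≡ A ⊎ₘ B → (∀ i → B ⊴ i → B′ ⊴ i) → φ A′ B′ ≈ χ A′ B′) →
           κ φ A B ≈ κ χ A B
  κ-cong {A} {B} = go (sorted B)
    where
    go : ∀ {B} {φ χ} → Sorted B →
         (∀ A′ B′ → A′ ⊎ₘ B′ ≡ A ⊎ₘ B → (∀ i → B ⊴ i → B′ ⊴ i) → φ A′ B′ ≈ χ A′ B′) →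
         κ φ A B ≈ κ χ A B
    go {φ = φ} {χ} [] φ≈χ rewrite κ-∅ φ A | κ-∅ χ A = φ≈χ A ∅ ≡.refl λ _ p → p
    go {φ = φ} {χ} (add {B} i B⊴i p) φ≈χ rewrite κ-insert φ A B⊴i | κ-insert χ A B⊴i = +-cong
      (*-congˡ (φ≈χ _ ∅ (⊎ₘ-identityʳ _) λ j _ → ∅-⊴ j))
      (*-congˡ (go p λ A′ B′ eq B′⊴ → φ≈χ A′ (insert i B′)
        (≡.trans (insert-⊎ₘʳ i A′ B′) (≡.trans (≡.cong (insert i) eq) (≡.sym (insert-⊎ₘʳ i A B))))
        λ j q → let B⊴j , i≤j = insert-⊴⁻¹ q in insert-⊴ (B′⊴ j B⊴j) i≤j))

  κ-cong′ : (∀ A B → φ A B ≈ χ A B) → ∀ A B → κ φ A B ≈ κ χ A B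
  κ-cong′ φ≈χ A B = κ-cong {A} {B} λ A′ B′ _ _ → φ≈χ A′ B′

  κ-scale : ∀ k χ A B → κ (λ A B → k * χ A B) A B ≈ k * κ χ A B
  κ-scale k χ A B = begin
    κ (λ A B → k * χ A B) A B        ≈⟨ κ-cong′ (λ _ _ → sym (+-identityˡ _)) A B ⟩
    κ (λ A B → 0# + k * χ A B) A B   ≈⟨ κ-linear (λ _ _ → 0#) k χ A B ⟩
    κ (λ _ _ → 0#) A B + k * κ χ A B ≈⟨ +-congʳ (κ-const 0# A B) ⟩
    0# + k * κ χ A B                 ≈⟨ +-identityˡ _ ⟩
    k * κ χ A B                      ∎

  onTop : Multiset s → (Fin s → Carrier) → Carrier
  onTop m f = maybe′ f 0# (strongest m)

  onTop-∅ : ∀ f → onTop ∅ f ≡ 0#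
  onTop-∅ f rewrite strongest-∅ {s} = ≡.refl

  onTop-insert : ∀ {i m} f → m ⊴ i → onTop (insert i m) f ≡ f i
  onTop-insert {i} f m⊴i rewrite strongest-insert i m⊴i = ≡.refl

  -- The gain term of a jump out of the second site: `ψ i` is the observable once particle i has
  -- reached its destination. An empty site contributes 0; the loss term is `occupied`.
  depart : (Fin s → Observable) → Observable
  depart ψ A B = onTop B λ i → ψ i A (remove i B)

  forward : Observable → Observable
  forward φ A B = onTop A λ i → φ (remove i A) (insert i B) - φ A B

  depart-insert : ∀ ψ A {i B} → B ⊴ i → depart ψ A (insert i B) ≡ ψ i A B
  depart-insert ψ A {i} {B} B⊴i = ≡.trans (onTop-insert _ B⊴i) (≡.cong (ψ i A) (remove-insert i B))

  forward-insert : ∀ φ {i A} B → A ⊴ i → forward φ (insert i A) B ≡ φ A (insert i B) - φ (insert i A) B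
  forward-insert φ {i} {A} B A⊴i = ≡.trans (onTop-insert _ A⊴i)
    (≡.cong (λ A′ → φ A′ (insert i B) - φ (insert i A) B) (remove-insert i A))

  -- With weight 1 - ρ the second site is emptied and nothing can depart. With weight ρ the
  -- strongest particle i of B stays, is the next one to leave, and the rest has been scattered
  -- independently of it. This turns departures at rate α into departures at rate αρ.
  κ-depart : ∀ ψ A B → κ (depart ψ) A B ≈ ρ * depart (λ i → κ (ψ i)) A B
  κ-depart ψ A B = go (sorted B)
    where
    go : ∀ {B} → Sorted B → κ (depart ψ) A B ≈ ρ * depart (λ i → κ (ψ i)) A B
    go [] = begin
      κ (depart ψ) A ∅                   ≡⟨ ≡.trans (κ-∅ (depart ψ) A) (onTop-∅ _) ⟩
      0#                                 ≈⟨ zeroʳ ρ ⟨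
      ρ * 0#                             ≡⟨ ≡.cong (ρ *_) (onTop-∅ _) ⟨
      ρ * depart (λ i → κ (ψ i)) A ∅     ∎
    go (add {B} i B⊴i _) = begin
      κ (depart ψ) A (insert i B)
        ≡⟨ κ-insert (depart ψ) A B⊴i ⟩
      (1# - ρ) * depart ψ (A ⊎ₘ insert i B) ∅ + ρ * κ (raise i (depart ψ)) A B
        ≈⟨ +-cong (*-congˡ (reflexive (onTop-∅ _)))
             (*-congˡ (κ-cong λ A′ B′ _ B′⊴ → reflexive (depart-insert ψ A′ (B′⊴ i B⊴i)))) ⟩
      (1# - ρ) * 0# + ρ * κ (ψ i) A B
        ≈⟨ solve 2 (λ ρ x → (:1 :- ρ) :* :0 :+ ρ :* x := ρ :* x) refl ρ _ ⟩
      ρ * κ (ψ i) A B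
        ≡⟨ ≡.cong (ρ *_) (depart-insert (λ i → κ (ψ i)) A B⊴i) ⟨
      ρ * depart (λ i → κ (ψ i)) A (insert i B) ∎

  -- Equals `φ A B` if B is nonempty and 0 otherwise, since the top particle is taken out and put
  -- back. In this form it is an instance of `depart`, so `κ-depart` covers it.
  occupied : Observable → Observable
  occupied φ = depart λ i → raise i φ

  -- `κ-∅` and `κ-insert` in a single equation: the difference with `occupied` survives only for
  -- empty B, the `depart` term only for nonempty B.
  κ-unfold : ∀ φ A B → κ φ A B ≈
    (1# - ρ) * φ (A ⊎ₘ B) ∅ + ρ * (κ φ A B - occupied (κ φ) A B + depart (λ i → κ (raise i φ)) A B)
  κ-unfold φ A B with sorted B
  ... | [] = begin
    κ φ A ∅
      ≈⟨ solve 2 (λ ρ x → x := (:1 :- ρ) :* x :+ ρ :* (x :- :0 :+ :0)) refl ρ (κ φ A ∅) ⟩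
    (1# - ρ) * κ φ A ∅ + ρ * (κ φ A ∅ - 0# + 0#)
      ≡⟨ ≡.cong₂ (λ x y → (1# - ρ) * x + ρ * y)
           (≡.trans (κ-∅ φ A) (≡.cong (λ A → φ A ∅) (≡.sym (⊎ₘ-identityʳ A))))
           (≡.sym (≡.cong₂ (λ x y → κ φ A ∅ - x + y) (onTop-∅ _) (onTop-∅ _))) ⟩
    (1# - ρ) * φ (A ⊎ₘ ∅) ∅ + ρ * (κ φ A ∅ - occupied (κ φ) A ∅ + depart (λ i → κ (raise i φ)) A ∅) ∎
  ... | add {B′} i B′⊴i _ = begin
    κ φ A (insert i B′)
      ≡⟨ κ-insert φ A B′⊴i ⟩
    (1# - ρ) * T + ρ * κ (raise i φ) A B′
      ≈⟨ solve 4 (λ ρ t y z → (:1 :- ρ) :* t :+ ρ :* z := (:1 :- ρ) :* t :+ ρ :* (y :- y :+ z))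
           refl ρ T (κ φ A (insert i B′)) _ ⟩
    (1# - ρ) * T + ρ * (κ φ A (insert i B′) - κ φ A (insert i B′) + κ (raise i φ) A B′)
      ≡⟨ ≡.cong₂ (λ x y → (1# - ρ) * T + ρ * (κ φ A (insert i B′) - x + y))
           (≡.sym (depart-insert (λ i → raise i (κ φ)) A B′⊴i))
           (≡.sym (depart-insert (λ i → κ (raise i φ)) A B′⊴i)) ⟩
    (1# - ρ) * T + ρ * (κ φ A (insert i B′) - occupied (κ φ) A (insert i B′)
      + depart (λ i → κ (raise i φ)) A (insert i B′)) ∎
    where
    T = φ (A ⊎ₘ insert i B′) ∅

  -- The part of the generator identity that is left when the factor α is taken out, `κ-depart` has
  -- matched the terms with ψ, and the loss terms have been moved to opposite sides to avoid
  -- subtraction.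
  ForwardIdentity : Observable → Multiset s → Multiset s → Set ℓ₁
  ForwardIdentity φ A B = forward (κ φ) A B + ρ * depart (λ i → κ (raise i φ)) A B ≈
                          ρ * (κ (forward φ) A B + occupied (κ φ) A B)

  -- The top particle of A is also the top one of every first component that κ produces.
  κ-forward-above : ∀ φ {m A B} → A ⊴ m → B ⊴ m → ForwardIdentity φ (insert m A) B
  κ-forward-above φ {m} {A} {B} A⊴m B⊴m = begin
    forward (κ φ) mA B + ρ * d
      ≡⟨ ≡.cong (_+ ρ * d) (≡.trans (forward-insert (κ φ) B A⊴m) (≡.cong (_- κ φ mA B) (κ-insert φ A B⊴m))) ⟩
    (1# - ρ) * φ (A ⊎ₘ insert m B) ∅ + ρ * X - κ φ mA B + ρ * d
      -- Moving m between the sites leaves the union unchanged, so the terms with emptied second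
      -- site agree and cancel against the one from `κ-unfold`.
      ≈⟨ +-congʳ (+-cong (+-congʳ (*-congˡ (reflexive (≡.cong (λ A → φ A ∅)
           (≡.trans (insert-⊎ₘʳ m A B) (≡.sym (insert-⊎ₘˡ m A B))))))) (-‿cong (κ-unfold φ mA B))) ⟩
    (1# - ρ) * T + ρ * X - ((1# - ρ) * T + ρ * (κ φ mA B - o + d)) + ρ * d
      ≈⟨ solve 6 (λ ρ t x y o d → (:1 :- ρ) :* t :+ ρ :* x :- ((:1 :- ρ) :* t :+ ρ :* (y :- o :+ d)) :+ ρ :* d
           := ρ :* (x :- y :+ o)) refl ρ T X (κ φ mA B) o d ⟩
    ρ * (X - κ φ mA B + o)
      ≈⟨ *-congˡ (+-congʳ forward≈) ⟨
    ρ * (κ (forward φ) mA B + o) ∎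
    where
    mA = insert m A
    T  = φ (mA ⊎ₘ B) ∅
    X  = κ (raise m φ) A B
    o  = occupied (κ φ) mA B
    d  = depart (λ i → κ (raise i φ)) mA B

    forward≈ : κ (forward φ) mA B ≈ X - κ φ mA B
    forward≈ = begin
      κ (forward φ) mA B
        ≈⟨ κ-shift {forward φ} {A} {B} m ⟩
      κ (λ A B → forward φ (insert m A) B) A B
        ≈⟨ κ-cong (λ A′ B′ eq _ → trans
             (reflexive (forward-insert φ B′ (⊴-⊎ₘˡ B′ (≡.subst (_⊴ m) (≡.sym eq) (⊎ₘ-⊴ A⊴m B⊴m)))))
             (solve 2 (λ x y → x :- y := x :+ (:- :1) :* y) refl _ _)) ⟩
      κ (λ A B → φ A (insert m B) + (- 1#) * φ (insert m A) B) A B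
        ≈⟨ κ-linear (raise m φ) (- 1#) (λ A B → φ (insert m A) B) A B ⟩
      X + (- 1#) * κ (λ A B → φ (insert m A) B) A B
        ≈⟨ +-congˡ (*-congˡ (κ-shift {φ} {A} {B} m)) ⟨
      X + (- 1#) * κ φ mA B
        ≈⟨ solve 2 (λ x y → x :+ (:- :1) :* y := x :- y) refl X _ ⟩
      X - κ φ mA B ∎

  -- A particle moved over from A is no stronger than i, so i is peeled off first both before and
  -- after the move. The terms with emptied second site cancel and a common factor ρ remains.
  forward-κ-below : ∀ φ {i A B} → A ⊴ i → B ⊴ i →
    forward (κ φ) A (insert i B) ≈ ρ * forward (κ (raise i φ)) A B
  forward-κ-below φ {i} {A} {B} A⊴i B⊴i with sorted A
  ... | [] = trans (reflexive (onTop-∅ _)) (trans (sym (zeroʳ ρ)) (*-congˡ (reflexive (≡.sym (onTop-∅ _)))))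
  ... | add {A′} m A′⊴m _ = begin
    forward (κ φ) (insert m A′) (insert i B)
      ≡⟨ forward-insert (κ φ) (insert i B) A′⊴m ⟩
    κ φ A′ (insert m (insert i B)) - κ φ (insert m A′) (insert i B)
      ≡⟨ ≡.cong₂ _-_ (≡.trans (≡.cong (κ φ A′) (insert-comm m i B))
           (κ-insert φ A′ (insert-⊴ B⊴i (proj₂ (insert-⊴⁻¹ A⊴i))))) (κ-insert φ (insert m A′) B⊴i) ⟩
    (1# - ρ) * φ (A′ ⊎ₘ insert i (insert m B)) ∅ + ρ * κ (raise i φ) A′ (insert m B)
      - ((1# - ρ) * φ (insert m A′ ⊎ₘ insert i B) ∅ + ρ * κ (raise i φ) (insert m A′) B)
      ≈⟨ +-congʳ (+-congʳ (*-congˡ (reflexive (≡.cong (λ A → φ A ∅) total≡)))) ⟩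
    (1# - ρ) * φ (insert m A′ ⊎ₘ insert i B) ∅ + ρ * κ (raise i φ) A′ (insert m B)
      - ((1# - ρ) * φ (insert m A′ ⊎ₘ insert i B) ∅ + ρ * κ (raise i φ) (insert m A′) B)
      ≈⟨ solve 4 (λ ρ t x y → (:1 :- ρ) :* t :+ ρ :* x :- ((:1 :- ρ) :* t :+ ρ :* y) := ρ :* (x :- y)) refl ρ _ _ _ ⟩
    ρ * (κ (raise i φ) A′ (insert m B) - κ (raise i φ) (insert m A′) B)
      ≡⟨ ≡.cong (ρ *_) (forward-insert (κ (raise i φ)) B A′⊴m) ⟨
    ρ * forward (κ (raise i φ)) (insert m A′) B ∎
    where
    total≡ : A′ ⊎ₘ insert i (insert m B) ≡ insert m A′ ⊎ₘ insert i B
    total≡ = ≡.trans (≡.cong (A′ ⊎ₘ_) (insert-comm i m B))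
      (≡.trans (insert-⊎ₘʳ m A′ (insert i B)) (≡.sym (insert-⊎ₘˡ m A′ (insert i B))))

  forward-raise : ∀ i φ A B → raise i (forward φ) A B ≡ forward (raise i φ) A B
  forward-raise i φ A B with strongest A
  ... | nothing = ≡.refl
  ... | just m  = ≡.cong (λ B → φ (remove m A) B - φ A (insert i _)) (insert-comm m i B)

  -- All terms reduce to observables in which i stays at the second site, with one exception: where
  -- κ has sent everything to the first site, `forward` moves i itself and changes T into U. The
  -- matching U comes from applying `κ-unfold` to the `depart` term.
  κ-forward-below : ∀ φ {i A B} → A ⊴ i → B ⊴ i →
    ForwardIdentity (raise i φ) A B → ForwardIdentity φ A (insert i B)
  κ-forward-below φ {i} {A} {B} A⊴i B⊴i ih = begin
    forward (κ φ) A iB + ρ * depart (λ i → κ (raise i φ)) A iB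
      ≈⟨ +-cong (forward-κ-below φ A⊴i B⊴i)
           (*-congˡ (trans (reflexive (depart-insert (λ i → κ (raise i φ)) A B⊴i)) (κ-unfold φᵢ A B))) ⟩
    ρ * f + ρ * ((1# - ρ) * U + ρ * (Z - o + d))
      ≈⟨ solve 6 (λ ρ f u z o d → ρ :* f :+ ρ :* ((:1 :- ρ) :* u :+ ρ :* (z :- o :+ d))
           := ρ :* ((:1 :- ρ) :* u :+ ρ :* z :+ (f :+ ρ :* d) :- ρ :* o)) refl ρ f U Z o d ⟩
    ρ * ((1# - ρ) * U + ρ * Z + (f + ρ * d) - ρ * o)
      ≈⟨ *-congˡ (+-congʳ (+-congˡ ih)) ⟩
    ρ * ((1# - ρ) * U + ρ * Z + ρ * (k + o) - ρ * o)
      ≈⟨ solve 6 (λ ρ u z k o t → ρ :* ((:1 :- ρ) :* u :+ ρ :* z :+ ρ :* (k :+ o) :- ρ :* o)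
           := ρ :* ((:1 :- ρ) :* (u :- t) :+ ρ :* k :+ ((:1 :- ρ) :* t :+ ρ :* z))) refl ρ U Z k o T ⟩
    ρ * ((1# - ρ) * (U - T) + ρ * k + ((1# - ρ) * T + ρ * Z))
      ≈⟨ *-congˡ (+-cong κ-forward≈ (reflexive (≡.trans (depart-insert (λ j → raise j (κ φ)) A B⊴i) (κ-insert φ A B⊴i)))) ⟨
    ρ * (κ (forward φ) A iB + occupied (κ φ) A iB) ∎
    where
    iB = insert i B
    φᵢ = raise i φ
    f  = forward (κ φᵢ) A B
    U  = φᵢ (A ⊎ₘ B) ∅
    Z  = κ φᵢ A B
    o  = occupied (κ φᵢ) A B
    d  = depart (λ j → κ (raise j φᵢ)) A B
    k  = κ (forward φᵢ) A B
    T  = φ (A ⊎ₘ iB) ∅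

    κ-forward≈ : κ (forward φ) A iB ≈ (1# - ρ) * (U - T) + ρ * k
    κ-forward≈ = begin
      κ (forward φ) A iB
        ≡⟨ κ-insert (forward φ) A B⊴i ⟩
      (1# - ρ) * forward φ (A ⊎ₘ iB) ∅ + ρ * κ (raise i (forward φ)) A B
        ≈⟨ +-cong (*-congˡ (reflexive top)) (*-congˡ (κ-cong′ (λ A B → reflexive (forward-raise i φ A B)) A B)) ⟩
      (1# - ρ) * (U - T) + ρ * k ∎
      where
      top : forward φ (A ⊎ₘ iB) ∅ ≡ U - T
      top rewrite insert-⊎ₘʳ i A B = forward-insert φ ∅ (⊎ₘ-⊴ A⊴i B⊴i)

  -- Split by the location of the overall strongest particle. At the first site (ties included) the
  -- identity is direct; at the second it is peeled off, and the induction on B continues with a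
  -- raised observable.
  κ-forward : ∀ φ A B → ForwardIdentity φ A B
  κ-forward φ A B = go φ (sorted A) (sorted B)
    where
    go : ∀ {A B} φ → Sorted A → Sorted B → ForwardIdentity φ A B
    go φ (add m A⊴m _) []             = κ-forward-above φ A⊴m (∅-⊴ m)
    go φ []            (add i B⊴i q)  = κ-forward-below φ (∅-⊴ i) B⊴i (go (raise i φ) [] q)
    go φ p@(add m A⊴m _) (add i B⊴i q) with ℕ.≤-total (toℕ i) (toℕ m)
    ... | inj₁ i≤m = κ-forward-above φ A⊴m (insert-⊴ (⊴-trans B⊴i i≤m) i≤m)
    ... | inj₂ m≤i = κ-forward-below φ (insert-⊴ (⊴-trans A⊴m m≤i) m≤i) B⊴i (go (raise i φ) p q)
    go φ [] [] = begin
      forward (κ φ) ∅ ∅ + ρ * depart (λ i → κ (raise i φ)) ∅ ∅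
        ≡⟨ ≡.cong₂ (λ x y → x + ρ * y) (onTop-∅ _) (onTop-∅ _) ⟩
      0# + ρ * 0#
        ≈⟨ solve 1 (λ ρ → :0 :+ ρ :* :0 := ρ :* (:0 :+ :0)) refl ρ ⟩
      ρ * (0# + 0#)
        ≡⟨ ≡.cong₂ (λ x y → ρ * (x + y)) (≡.trans (κ-∅ (forward φ) ∅) (onTop-∅ _)) (onTop-∅ _) ⟨
      ρ * (κ (forward φ) ∅ ∅ + occupied (κ φ) ∅ ∅) ∎

  leave : Observable → (Fin s → Observable) → Observable
  leave φ ψ A B = onTop B λ i → ψ i A (remove i B) - φ A B

  leave≈ : ∀ φ ψ A B → leave φ ψ A B ≈ depart ψ A B - occupied φ A B
  leave≈ φ ψ A B with sorted B
  ... | [] = trans (reflexive (onTop-∅ _)) (trans (sym (-‿inverseʳ 0#))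
    (reflexive (≡.sym (≡.cong₂ _-_ (onTop-∅ _) (onTop-∅ _)))))
  ... | add {B′} i B′⊴i _ = reflexive (≡.trans (onTop-insert _ B′⊴i)
    (≡.cong₂ _-_ (≡.trans (≡.cong (ψ i A) (remove-insert i B′)) (≡.sym (depart-insert ψ A B′⊴i)))
      (≡.sym (depart-insert (λ i → raise i φ) A B′⊴i))))

  -- The pair's share of L K = K L′, with rates (α, αρ) on the left and (αρ, α) on the right.
  -- `κ-depart` is used twice, for the gain term ψ and for the loss term `occupied φ`; adding and
  -- subtracting αρ d prepares for `κ-forward`.
  κ-exchange : ∀ α φ ψ A B →
    α * forward (κ φ) A B + α * ρ * leave (κ φ) (λ i → κ (ψ i)) A B ≈
    κ (λ A B → α * ρ * forward φ A B + α * leave φ ψ A B) A B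
  κ-exchange α φ ψ A B = begin
    α * f + α * ρ * leave (κ φ) (λ i → κ (ψ i)) A B
      ≈⟨ +-congˡ (*-congˡ (leave≈ (κ φ) (λ i → κ (ψ i)) A B)) ⟩
    α * f + α * ρ * (D - o)
      ≈⟨ solve 6 (λ α ρ f D o d → α :* f :+ α :* ρ :* (D :- o)
           := α :* (f :+ ρ :* d) :- α :* ρ :* d :+ α :* ρ :* (D :- o)) refl α ρ f D o d ⟩
    α * (f + ρ * d) - α * ρ * d + α * ρ * (D - o)
      ≈⟨ +-congʳ (+-congʳ (*-congˡ (κ-forward φ A B))) ⟩
    α * (ρ * (k + o)) - α * ρ * d + α * ρ * (D - o)
      ≈⟨ solve 6 (λ α ρ k D o d → α :* (ρ :* (k :+ o)) :- α :* ρ :* d :+ α :* ρ :* (D :- o)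
           := α :* ρ :* k :+ α :* (ρ :* D) :+ (:- α) :* (ρ :* d)) refl α ρ k D o d ⟩
    α * ρ * k + α * (ρ * D) + (- α) * (ρ * d)
      ≈⟨ +-cong (+-cong (κ-scale (α * ρ) (forward φ) A B) (*-congˡ (κ-depart ψ A B)))
           (*-congˡ (κ-depart (λ i → raise i φ) A B)) ⟨
    κ (λ A B → α * ρ * forward φ A B) A B + α * κ (depart ψ) A B + (- α) * κ (occupied φ) A B
      ≈⟨ +-congʳ (κ-linear _ α (depart ψ) A B) ⟨
    κ (λ A B → α * ρ * forward φ A B + α * depart ψ A B) A B + (- α) * κ (occupied φ) A B
      ≈⟨ κ-linear _ (- α) (occupied φ) A B ⟨
    κ (λ A B → α * ρ * forward φ A B + α * depart ψ A B + (- α) * occupied φ A B) A B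
      ≈⟨ κ-cong′ (λ A B → trans
           (solve 5 (λ α ρ f d o → α :* ρ :* f :+ α :* d :+ (:- α) :* o
             := α :* ρ :* f :+ α :* (d :- o)) refl α ρ _ _ _)
           (+-congˡ (*-congˡ (sym (leave≈ φ ψ A B))))) A B ⟩
    κ (λ A B → α * ρ * forward φ A B + α * leave φ ψ A B) A B ∎
    where
    f = forward (κ φ) A B
    D = depart (λ i → κ (ψ i)) A B
    o = occupied (κ φ) A B
    d = depart (λ i → κ (raise i φ)) A B
    k = κ (forward φ) A B

-- Conservation of content and the neighbouring pair on the ring

⊎ₘ-comm : ∀ {s} (m m′ : Multiset s) → m ⊎ₘ m′ ≡ m′ ⊎ₘ m
⊎ₘ-comm = Vec.zipWith-comm ℕ.+-comm

⊎ₘ-assoc : ∀ {s} (m m′ m″ : Multiset s) → (m ⊎ₘ m′) ⊎ₘ m″ ≡ m ⊎ₘ (m′ ⊎ₘ m″)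
⊎ₘ-assoc = Vec.zipWith-assoc ℕ.+-assoc

⊎ₘ-cancelʳ : ∀ {s} (p m m′ : Multiset s) → m ⊎ₘ p ≡ m′ ⊎ₘ p → m ≡ m′
⊎ₘ-cancelʳ []      []      []        _  = ≡.refl
⊎ₘ-cancelʳ (x ∷ p) (k ∷ m) (k′ ∷ m′) eq = ≡.cong₂ _∷_
  (ℕ.+-cancelʳ-≡ x k k′ (Vec.∷-injectiveˡ eq)) (⊎ₘ-cancelʳ p m m′ (Vec.∷-injectiveʳ eq))

-- A balance equation, which avoids subtracting multisets; `⊎ₘ-cancelʳ` extracts the equality of
-- contents later.
content-replace : ∀ {n s} (η : Sites n s) j A →
                  content (η [ j ]≔ A) ⊎ₘ lookup η j ≡ content η ⊎ₘ A
content-replace (m ∷ η) zero    A = ≡.trans (⊎ₘ-comm _ m)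
  (≡.trans (≡.cong (m ⊎ₘ_) (⊎ₘ-comm A (content η))) (≡.sym (⊎ₘ-assoc m (content η) A)))
content-replace (m ∷ η) (suc j) A = ≡.trans (⊎ₘ-assoc m _ _)
  (≡.trans (≡.cong (m ⊎ₘ_) (content-replace η j A)) (≡.sym (⊎ₘ-assoc m (content η) A)))

content-insert : ∀ {n s} (η : Sites n s) j i → content (η [ j ]%= insert i) ≡ insert i (content η)
content-insert (m ∷ η) zero    i = insert-⊎ₘˡ i m (content η)
content-insert (m ∷ η) (suc j) i =
  ≡.trans (≡.cong (m ⊎ₘ_) (content-insert η j i)) (insert-⊎ₘʳ i m (content η))

strongest-just⇒insert-remove : ∀ {s} (m : Multiset s) {i} → strongest m ≡ just i → insert i (remove i m) ≡ m
strongest-just⇒insert-remove m eq with sorted m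
... | [] = contradiction (≡.trans (≡.sym eq) strongest-∅) λ ()
... | add {m′} j m′⊴j _ with ≡.trans (≡.sym eq) (strongest-insert j m′⊴j)
...   | ≡.refl = ≡.cong (insert j) (remove-insert j m′)

move : ∀ {n s} → Fin n → Fin s → Sites n s → Sites n s
move j i η = (η [ j ]%= remove i) [ next j ]%= insert i

content-move : ∀ {n s} (η : Sites n s) j {i} → strongest (lookup η j) ≡ just i → content (move j i η) ≡ content η
content-move η j {i} eq = ≡.trans (content-insert (η [ j ]%= remove i) (next j) i)
  (≡.trans (≡.sym (content-insert (η [ j ]%= remove i) j i))
    (≡.cong content (≡.trans (Vec.updateAt-updateAt j η)
      (Vec.updateAt-id-local j η (strongest-just⇒insert-remove (lookup η j) eq)))))

toℕ-next-< : ∀ {n} (j : Fin n) → suc (toℕ j) ℕ.< n → toℕ (next j) ≡ suc (toℕ j)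
toℕ-next-< {suc n} j lt = ≡.trans (Fin.toℕ-fromℕ< _) (m<n⇒m%n≡m lt)

toℕ-next-≡ : ∀ {n} (j : Fin n) → suc (toℕ j) ≡ n → toℕ (next j) ≡ 0
toℕ-next-≡ {suc n} j eq = ≡.trans (Fin.toℕ-fromℕ< _)
  (≡.trans (≡.cong (_% suc n) eq) (n%n≡0 (suc n)))

next-view : ∀ {n} (j : Fin n) → toℕ (next j) ≡ suc (toℕ j) ⊎ toℕ (next j) ≡ 0
next-view j with ℕ.m≤n⇒m<n∨m≡n (Fin.toℕ<n j)
... | inj₁ lt = inj₁ (toℕ-next-< j lt)
... | inj₂ eq = inj₂ (toℕ-next-≡ j eq)

module _ {n : ℕ} {a b : Fin n} (b≡1+a : toℕ b ≡ suc (toℕ a)) where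

  next-a≡b : next a ≡ b
  next-a≡b = Fin.toℕ-injective
    (≡.trans (toℕ-next-< a (≡.subst (ℕ._< n) b≡1+a (Fin.toℕ<n b))) (≡.sym b≡1+a))

  next≡b⇒≡a : ∀ j → next j ≡ b → j ≡ a
  next≡b⇒≡a j eq with next-view j
  ... | inj₁ q = Fin.toℕ-injective (ℕ.suc-injective (≡.trans (≡.sym q) (≡.trans (≡.cong toℕ eq) b≡1+a)))
  ... | inj₂ q = contradiction (≡.trans (≡.sym q) (≡.trans (≡.cong toℕ eq) b≡1+a)) λ ()

  a≢b : a ≢ b
  a≢b ≡.refl = ℕ.1+n≢n (≡.sym b≡1+a)

  next-b≢b : next b ≢ b
  next-b≢b eq = a≢b (≡.sym (next≡b⇒≡a b eq))

  -- The successor of b is either b + 1 or, after wrapping around, site 0. The latter is an observed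
  -- site, as expressed by the hypothesis on a.
  next-b≢a : 0 ℕ.< toℕ a → next b ≢ a
  next-b≢a 0<a eq with next-view b
  ... | inj₁ q = ℕ.m≢1+m+n (toℕ a) (≡.trans (≡.cong toℕ (≡.sym eq)) (≡.trans q
    (≡.trans (≡.cong suc b≡1+a) (≡.cong suc (≡.sym (ℕ.+-comm (toℕ a) 1))))))
  ... | inj₂ q = ℕ.<⇒≢ 0<a (≡.trans (≡.sym q) (≡.cong toℕ eq))

module Put {n s : ℕ} {a b : Fin n} (a≢b : a ≢ b) where

  put : Sites n s → Multiset s → Multiset s → Sites n s
  put η A B = (η [ a ]≔ A) [ b ]≔ B

  private variable
    f : Multiset s → Multiset s

  lookup-put-a : ∀ η A B → lookup (put η A B) a ≡ A
  lookup-put-a η A B = ≡.trans (Vec.lookup∘updateAt′ a b a≢b (η [ a ]≔ A)) (Vec.lookup∘updateAt a η)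

  lookup-put-b : ∀ η A B → lookup (put η A B) b ≡ B
  lookup-put-b η A B = Vec.lookup∘updateAt b (η [ a ]≔ A)

  lookup-put-other : ∀ η A B {k} → k ≢ a → k ≢ b → lookup (put η A B) k ≡ lookup η k
  lookup-put-other η A B {k} k≢a k≢b =
    ≡.trans (Vec.lookup∘updateAt′ k b k≢b (η [ a ]≔ A)) (Vec.lookup∘updateAt′ k a k≢a η)

  put-lookup : ∀ η → put η (lookup η a) (lookup η b) ≡ η
  put-lookup η = ≡.trans (≡.cong (_[ b ]≔ lookup η b) (Vec.[]≔-lookup η a)) (Vec.[]≔-lookup η b)

  update-a-put : ∀ η A B → put η A B [ a ]%= f ≡ put η (f A) B
  update-a-put η A B = ≡.trans (Vec.updateAt-commutes a b a≢b (η [ a ]≔ A))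
    (≡.cong (_[ b ]≔ B) (Vec.updateAt-updateAt a η))

  update-b-put : ∀ η A B → put η A B [ b ]%= f ≡ put η A (f B)
  update-b-put η A B = Vec.updateAt-updateAt b (η [ a ]≔ A)

  update-put : ∀ η A B {k} → k ≢ a → k ≢ b → put η A B [ k ]%= f ≡ put (η [ k ]%= f) A B
  update-put η A B {k} k≢a k≢b = ≡.trans (Vec.updateAt-commutes k b k≢b (η [ a ]≔ A))
    (≡.cong (_[ b ]≔ B) (Vec.updateAt-commutes k a k≢a η))

  put-update-a : ∀ η A B → put (η [ a ]%= f) A B ≡ put η A B
  put-update-a η A B = ≡.cong (_[ b ]≔ B) (Vec.updateAt-updateAt a η)

  put-put : ∀ η A B A′ B′ → put (put η A B) A′ B′ ≡ put η A′ B′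
  put-put η A B A′ B′ = ≡.trans (≡.cong (_[ b ]≔ B′) (update-a-put η A B)) (update-b-put η A′ B)

  content-put : ∀ η A B → A ⊎ₘ B ≡ lookup η a ⊎ₘ lookup η b → content (put η A B) ≡ content η
  content-put η A B eq = ⊎ₘ-cancelʳ (lookup η a ⊎ₘ lookup η b) _ _ (begin
    content (put η A B) ⊎ₘ (lookup η a ⊎ₘ lookup η b)
      ≡⟨ ≡.cong (content (put η A B) ⊎ₘ_) (⊎ₘ-comm (lookup η a) (lookup η b)) ⟩
    content (put η A B) ⊎ₘ (lookup η b ⊎ₘ lookup η a)
      ≡⟨ ⊎ₘ-assoc _ (lookup η b) (lookup η a) ⟨
    (content (put η A B) ⊎ₘ lookup η b) ⊎ₘ lookup η a
      ≡⟨ ≡.cong (λ m → (content (put η A B) ⊎ₘ m) ⊎ₘ lookup η a)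
           (Vec.lookup∘updateAt′ b a (a≢b ∘ ≡.sym) η) ⟨
    (content (put η A B) ⊎ₘ lookup (η [ a ]≔ A) b) ⊎ₘ lookup η a
      ≡⟨ ≡.cong (_⊎ₘ lookup η a) (content-replace (η [ a ]≔ A) b B) ⟩
    (content (η [ a ]≔ A) ⊎ₘ B) ⊎ₘ lookup η a
      ≡⟨ ⊎ₘ-assoc _ B (lookup η a) ⟩
    content (η [ a ]≔ A) ⊎ₘ (B ⊎ₘ lookup η a)
      ≡⟨ ≡.cong (content (η [ a ]≔ A) ⊎ₘ_) (⊎ₘ-comm B (lookup η a)) ⟩
    content (η [ a ]≔ A) ⊎ₘ (lookup η a ⊎ₘ B)
      ≡⟨ ⊎ₘ-assoc _ (lookup η a) B ⟨
    (content (η [ a ]≔ A) ⊎ₘ lookup η a) ⊎ₘ B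
      ≡⟨ ≡.cong (_⊎ₘ B) (content-replace η a A) ⟩
    (content η ⊎ₘ A) ⊎ₘ B
      ≡⟨ ⊎ₘ-assoc (content η) A B ⟩
    content η ⊎ₘ (A ⊎ₘ B)
      ≡⟨ ≡.cong (content η ⊎ₘ_) eq ⟩
    content η ⊎ₘ (lookup η a ⊎ₘ lookup η b) ∎)
    where open ≡.≡-Reasoning

truncate-update : ∀ {n ℓ} {A : Set} (ℓ≤n : ℓ ℕ.≤ n) (xs : Vec A n) {j} {f : A → A} →
                  ℓ ℕ.≤ toℕ j → truncate ℓ≤n (xs [ j ]%= f) ≡ truncate ℓ≤n xs
truncate-update ℕ.z≤n       xs       _                     = ≡.refl
truncate-update (ℕ.s≤s ℓ≤n) (x ∷ xs) {suc j} (ℕ.s≤s ℓ≤j) = ≡.cong (x ∷_) (truncate-update ℓ≤n xs ℓ≤j)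

-- Generators and the interchange kernel on the whole ring

module Difference {c ℓ₁ ℓ₂ ℓ₃} (F : OrderedField c ℓ₁ ℓ₂ ℓ₃) {n s : ℕ} where

  open OrderedFieldProperties F

  -- Acts on functions of all site vectors, whatever their content, so that the pair of sites can be
  -- overwritten freely; the content is restored only when passing to `Config`.
  Δ : Fin n → (Sites n s → Carrier) → Sites n s → Carrier
  Δ j G η = maybe′ (λ ζ → G ζ - G η) 0# (hop j η)

  Δ-strongest : ∀ j G η → Δ j G η ≡ maybe′ (λ i → G (move j i η) - G η) 0# (strongest (lookup η j))
  Δ-strongest j G η with strongest (lookup η j)
  ... | nothing = ≡.refl
  ... | just _  = ≡.refl

  Δ-cong : ∀ j {G H} η → (∀ ζ → content ζ ≡ content η → G ζ ≈ H ζ) → Δ j G η ≈ Δ j H η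
  Δ-cong j {G} {H} η G≈H
    rewrite Δ-strongest j G η | Δ-strongest j H η
    with strongest (lookup η j) in eq
  ... | nothing = refl
  ... | just i  = +-cong (G≈H _ (content-move η j eq)) (-‿cong (G≈H η ≡.refl))

  𝓛 : (Fin n → Carrier) → (Sites n s → Carrier) → Sites n s → Carrier
  𝓛 r G η = ∑ (allFin n) λ j → r j * Δ j G η

module Exchange {c ℓ₁ ℓ₂ ℓ₃} (F : OrderedField c ℓ₁ ℓ₂ ℓ₃) {n : ℕ} (s : ℕ) {a b : Fin n}
  (0<a : 0 ℕ.< toℕ a) (b≡1+a : toℕ b ≡ suc (toℕ a)) (ρ : OrderedField.Carrier F) where

  open OrderedFieldProperties F
  open Swapping F {s} ρ
  open Difference F {n} {s}
  open SetoidReasoning setoid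
  private a≢b′ = a≢b b≡1+a
  open Put {n} {s} a≢b′

  slice : (Sites n s → Carrier) → Sites n s → Observable
  slice G η A B = G (put η A B)

  𝓚 : (Sites n s → Carrier) → Sites n s → Carrier
  𝓚 G η = κ (slice G η) (lookup η a) (lookup η b)

  𝓚-put : ∀ G η A B → 𝓚 G (put η A B) ≈ κ (slice G η) A B
  𝓚-put G η A B rewrite lookup-put-a η A B | lookup-put-b η A B =
    κ-cong′ (λ A′ B′ → reflexive (≡.cong G (put-put η A B A′ B′))) A B

  slice-lookup : ∀ G η → slice G η (lookup η a) (lookup η b) ≡ G η
  slice-lookup G η = ≡.cong G (put-lookup η)

  Δ-a : ∀ G η A B → Δ a G (put η A B) ≈ forward (slice G η) A B
  Δ-a G η A B rewrite Δ-strongest a G (put η A B) | lookup-put-a η A B with strongest A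
  ... | nothing = refl
  ... | just i  = +-congʳ (reflexive (≡.cong G (≡.trans
    (≡.cong (λ j → (put η A B [ a ]%= remove i) [ j ]%= insert i) (next-a≡b b≡1+a))
    (≡.trans (≡.cong (_[ b ]%= insert i) (update-a-put η A B)) (update-b-put η (remove i A) B)))))

  exits : (Sites n s → Carrier) → Sites n s → Fin s → Observable
  exits G η i = slice G (η [ next b ]%= insert i)

  Δ-b : ∀ G η A B → Δ b G (put η A B) ≈ leave (slice G η) (exits G η) A B
  Δ-b G η A B rewrite Δ-strongest b G (put η A B) | lookup-put-b η A B with strongest B
  ... | nothing = refl
  ... | just i  = +-congʳ (reflexive (≡.cong G (≡.trans
    (≡.cong (_[ next b ]%= insert i) (update-b-put η A B))
    (update-put η A (remove i B) (next-b≢a b≡1+a 0<a) (next-b≢b b≡1+a)))))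

  onTop-cong : ∀ m {f g} → (∀ i → f i ≈ g i) → onTop m f ≈ onTop m g
  onTop-cong m f≈g with strongest m
  ... | nothing = refl
  ... | just i  = f≈g i

  Δ-a-𝓚 : ∀ G η → Δ a (𝓚 G) η ≈ forward (κ (slice G η)) (lookup η a) (lookup η b)
  Δ-a-𝓚 G η = begin
    Δ a (𝓚 G) η                                             ≡⟨ ≡.cong (Δ a (𝓚 G)) (put-lookup η) ⟨
    Δ a (𝓚 G) (put η (lookup η a) (lookup η b))             ≈⟨ Δ-a (𝓚 G) η (lookup η a) (lookup η b) ⟩
    forward (slice (𝓚 G) η) (lookup η a) (lookup η b)
      ≈⟨ onTop-cong (lookup η a) (λ i → +-cong (𝓚-put G η _ _) (-‿cong (𝓚-put G η _ _))) ⟩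
    forward (κ (slice G η)) (lookup η a) (lookup η b)       ∎

  Δ-b-𝓚 : ∀ G η → Δ b (𝓚 G) η ≈
    leave (κ (slice G η)) (λ i → κ (exits G η i)) (lookup η a) (lookup η b)
  Δ-b-𝓚 G η = begin
    Δ b (𝓚 G) η                                             ≡⟨ ≡.cong (Δ b (𝓚 G)) (put-lookup η) ⟨
    Δ b (𝓚 G) (put η (lookup η a) (lookup η b))             ≈⟨ Δ-b (𝓚 G) η (lookup η a) (lookup η b) ⟩
    leave (slice (𝓚 G) η) (exits (𝓚 G) η) (lookup η a) (lookup η b)
      ≈⟨ onTop-cong (lookup η b) (λ i → +-cong (𝓚-put G _ _ _) (-‿cong (𝓚-put G η _ _))) ⟩
    leave (κ (slice G η)) (λ i → κ (exits G η i)) (lookup η a) (lookup η b) ∎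

  -- A hop from another site either enters a, where `κ-shift` lets the arrival commute with the
  -- kernel, or avoids the pair. It cannot enter b, whose only predecessor is a.
  𝓚-move : ∀ G η {j} i → j ≢ a → j ≢ b →
    κ (λ A B → G (move j i (put η A B))) (lookup η a) (lookup η b) ≈ 𝓚 G (move j i η)
  𝓚-move G η {j} i j≢a j≢b with next j Fin.≟ a
  ... | yes ≡.refl = begin
    κ (λ A B → G (move j i (put η A B))) (lookup η a) (lookup η b)
      ≈⟨ κ-cong′ (λ A B → reflexive (≡.cong G (≡.trans
           (≡.cong (_[ a ]%= insert i) (update-put η A B j≢a j≢b))
           (≡.trans (update-a-put (η [ j ]%= remove i) A B)
             (≡.sym (put-update-a (η [ j ]%= remove i) (insert i A) B)))))) _ _ ⟩
    κ (λ A B → slice G ζ (insert i A) B) (lookup η a) (lookup η b)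
      ≈⟨ κ-shift {slice G ζ} i ⟨
    κ (slice G ζ) (insert i (lookup η a)) (lookup η b)
      ≡⟨ ≡.cong₂ (κ (slice G ζ))
           (≡.trans (Vec.lookup∘updateAt a (η [ j ]%= remove i)) (≡.cong (insert i) (Vec.lookup∘updateAt′ a j (j≢a ∘ ≡.sym) η)))
           (≡.trans (Vec.lookup∘updateAt′ b a (a≢b′ ∘ ≡.sym) (η [ j ]%= remove i)) (Vec.lookup∘updateAt′ b j (j≢b ∘ ≡.sym) η)) ⟨
    𝓚 G ζ ∎
    where
    ζ = move j i η
  ... | no next≢a = begin
    κ (λ A B → G (move j i (put η A B))) (lookup η a) (lookup η b)
      ≈⟨ κ-cong′ (λ A B → reflexive (≡.cong G (≡.trans
           (≡.cong (_[ next j ]%= insert i) (update-put η A B j≢a j≢b))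
           (update-put (η [ j ]%= remove i) A B next≢a next≢b)))) _ _ ⟩
    κ (slice G ζ) (lookup η a) (lookup η b)
      ≡⟨ ≡.cong₂ (κ (slice G ζ)) (lookup-other a (next≢a ∘ ≡.sym) (j≢a ∘ ≡.sym))
           (lookup-other b (next≢b ∘ ≡.sym) (j≢b ∘ ≡.sym)) ⟨
    𝓚 G ζ ∎
    where
    ζ = move j i η
    next≢b : next j ≢ b
    next≢b eq = j≢a (next≡b⇒≡a b≡1+a j eq)
    lookup-other : ∀ k → k ≢ next j → k ≢ j → lookup ζ k ≡ lookup η k
    lookup-other k k≢next k≢j = ≡.trans (Vec.lookup∘updateAt′ k (next j) k≢next (η [ j ]%= remove i))
      (Vec.lookup∘updateAt′ k j k≢j η)

  Δ-other : ∀ G η {j} → j ≢ a → j ≢ b → Δ j (𝓚 G) η ≈ 𝓚 (Δ j G) η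
  Δ-other G η {j} j≢a j≢b = begin
    Δ j (𝓚 G) η
      ≡⟨ Δ-strongest j (𝓚 G) η ⟩
    onTop (lookup η j) (λ i → 𝓚 G (move j i η) - 𝓚 G η)
      ≈⟨ under (lookup η j) ⟩
    κ (λ A B → onTop (lookup η j) λ i → G (move j i (put η A B)) - G (put η A B)) (lookup η a) (lookup η b)
      ≈⟨ κ-cong′ (λ A B → reflexive (≡.trans
           (≡.cong (λ m → onTop m λ i → G (move j i (put η A B)) - G (put η A B)) (≡.sym (lookup-put-other η A B j≢a j≢b)))
           (≡.sym (Δ-strongest j G (put η A B))))) _ _ ⟩
    𝓚 (Δ j G) η ∎
    where
    under : ∀ m → onTop m (λ i → 𝓚 G (move j i η) - 𝓚 G η) ≈
      κ (λ A B → onTop m λ i → G (move j i (put η A B)) - G (put η A B)) (lookup η a) (lookup η b)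
    under m with strongest m
    ... | nothing = sym (κ-const 0# _ _)
    ... | just i  = begin
      𝓚 G (move j i η) - 𝓚 G η
        ≈⟨ +-congʳ (𝓚-move G η i j≢a j≢b) ⟨
      κ (λ A B → G (move j i (put η A B))) (lookup η a) (lookup η b) - 𝓚 G η
        ≈⟨ solve 2 (λ x y → x :- y := x :+ (:- :1) :* y) refl _ _ ⟩
      κ (λ A B → G (move j i (put η A B))) (lookup η a) (lookup η b) + (- 1#) * 𝓚 G η
        ≈⟨ κ-linear _ (- 1#) (slice G η) _ _ ⟨
      κ (λ A B → G (move j i (put η A B)) + (- 1#) * G (put η A B)) (lookup η a) (lookup η b)
        ≈⟨ κ-cong′ (λ A B → solve 2 (λ x y → x :+ (:- :1) :* y := x :- y) refl _ _) _ _ ⟩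
      κ (λ A B → G (move j i (put η A B)) - G (put η A B)) (lookup η a) (lookup η b) ∎

  𝓚-linear : ∀ G k H η → 𝓚 (λ ζ → G ζ + k * H ζ) η ≈ 𝓚 G η + k * 𝓚 H η
  𝓚-linear G k H η = κ-linear (slice G η) k (slice H η) _ _

  𝓚-cong : ∀ {G H} η → (∀ ζ → content ζ ≡ content η → G ζ ≈ H ζ) → 𝓚 G η ≈ 𝓚 H η
  𝓚-cong η G≈H = κ-cong λ A B eq _ → G≈H _ (content-put η A B eq)

  𝓚-∑ : ∀ {i} {I : Set i} (xs : List I) (w : I → Carrier) (G : I → Sites n s → Carrier) η →
        𝓚 (λ ζ → ∑ xs λ x → w x * G x ζ) η ≈ ∑ xs λ x → w x * 𝓚 (G x) η
  𝓚-∑ []       w G η = κ-const 0# _ _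
  𝓚-∑ (x ∷ xs) w G η = begin
    𝓚 (λ ζ → w x * G x ζ + ∑ xs λ x → w x * G x ζ) η
      ≈⟨ κ-cong′ (λ _ _ → +-comm _ _) _ _ ⟩
    𝓚 (λ ζ → (∑ xs λ x → w x * G x ζ) + w x * G x ζ) η
      ≈⟨ 𝓚-linear (λ ζ → ∑ xs λ x → w x * G x ζ) (w x) (G x) η ⟩
    𝓚 (λ ζ → ∑ xs λ x → w x * G x ζ) η + w x * 𝓚 (G x) η
      ≈⟨ +-congʳ (𝓚-∑ xs w G η) ⟩
    (∑ xs λ x → w x * 𝓚 (G x) η) + w x * 𝓚 (G x) η
      ≈⟨ +-comm _ _ ⟩
    w x * 𝓚 (G x) η + (∑ xs λ x → w x * 𝓚 (G x) η) ∎

  𝓚-empty : ∀ G η → lookup η a ≡ ∅ → lookup η b ≡ ∅ → 𝓚 G η ≈ G η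
  𝓚-empty G η ηa≡∅ ηb≡∅ = begin
    κ (slice G η) (lookup η a) (lookup η b) ≡⟨ ≡.cong₂ (κ (slice G η)) ηa≡∅ ηb≡∅ ⟩
    κ (slice G η) ∅ ∅                       ≡⟨ κ-∅ (slice G η) ∅ ⟩
    slice G η ∅ ∅                           ≡⟨ ≡.cong₂ (slice G η) ηa≡∅ ηb≡∅ ⟨
    slice G η (lookup η a) (lookup η b)     ≡⟨ slice-lookup G η ⟩
    G η                                     ∎

  𝓚-bound : 0# ≤ ρ → ∀ {G M} → (∀ ζ → ∣ G ζ ∣≤ M) → ∀ η →
            ∣ 𝓚 G η ∣≤ scatterNorm (descending (lookup η b)) * M
  𝓚-bound 0≤ρ G≤M η = κ-bound {A = lookup η a} {lookup η b} 0≤ρ λ A B → G≤M (put η A B)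

  -- The defect of intertwining is a sum over sites. It vanishes at each site off the pair, whereas
  -- those of a and b cancel only together, by `κ-exchange`.
  𝓚-intertwines : ∀ {r r′ : Fin n → Carrier} → r b ≈ r a * ρ → r′ a ≈ r b → r′ b ≈ r a →
    (∀ j → j ≢ a → j ≢ b → r′ j ≈ r j) → ∀ G η → 𝓛 r (𝓚 G) η ≈ 𝓚 (𝓛 r′ G) η
  𝓚-intertwines {r} {r′} rb≈raρ r′a≈rb r′b≈ra r′≈r G η = begin
    𝓛 r (𝓚 G) η
      ≈⟨ solve 2 (λ x y → x := x :- y :+ y) refl _ _ ⟩
    𝓛 r (𝓚 G) η - (∑ (allFin n) λ j → r′ j * 𝓚 (Δ j G) η) + (∑ (allFin n) λ j → r′ j * 𝓚 (Δ j G) η)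
      ≈⟨ +-cong (sym (∑-- (allFin n) _ _)) (sym (𝓚-∑ (allFin n) r′ (λ j → Δ j G) η)) ⟩
    ∑ (allFin n) defect + 𝓚 (𝓛 r′ G) η
      ≈⟨ +-congʳ (trans (∑-cong (allFin n) split) (trans (∑-+ (allFin n) _ _)
           (+-cong (pick a) (pick b)))) ⟩
    defect a + defect b + 𝓚 (𝓛 r′ G) η
      ≈⟨ +-congʳ cancel ⟩
    0# + 𝓚 (𝓛 r′ G) η
      ≈⟨ +-identityˡ _ ⟩
    𝓚 (𝓛 r′ G) η ∎
    where
    defect : Fin n → Carrier
    defect j = r j * Δ j (𝓚 G) η - r′ j * 𝓚 (Δ j G) η

    pick : ∀ k → ∑ (allFin n) (λ j → 𝟙 (k Fin.≟ j) * defect j) ≈ defect k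
    pick k = ∑-𝟙 (k Fin.≟_) {defect} (allFin⁺ n) (∈-allFin k) ≡.refl (λ _ eq → eq)

    split : ∀ j → defect j ≈ 𝟙 (a Fin.≟ j) * defect j + 𝟙 (b Fin.≟ j) * defect j
    split j with a Fin.≟ j | b Fin.≟ j
    ... | yes ≡.refl | yes b≡a    = contradiction (≡.sym b≡a) a≢b′
    ... | yes _      | no  _      = solve 1 (λ x → x := :1 :* x :+ :0 :* x) refl (defect j)
    ... | no  _      | yes _      = solve 1 (λ x → x := :0 :* x :+ :1 :* x) refl (defect j)
    ... | no  a≢j    | no  b≢j    = trans
      (trans (+-cong (*-congˡ (Δ-other G η (a≢j ∘ ≡.sym) (b≢j ∘ ≡.sym)))
               (-‿cong (*-congʳ (r′≈r j (a≢j ∘ ≡.sym) (b≢j ∘ ≡.sym))))) (-‿inverseʳ _))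
      (solve 1 (λ x → :0 := :0 :* x :+ :0 :* x) refl (defect j))

    α = r a
    φ = slice G η
    A = lookup η a
    B = lookup η b

    𝓚Δ-a : 𝓚 (Δ a G) η ≈ κ (forward φ) A B
    𝓚Δ-a = κ-cong′ (Δ-a G η) A B

    𝓚Δ-b : 𝓚 (Δ b G) η ≈ κ (leave φ (exits G η)) A B
    𝓚Δ-b = κ-cong′ (Δ-b G η) A B

    exchange : r a * Δ a (𝓚 G) η + r b * Δ b (𝓚 G) η ≈ r′ a * 𝓚 (Δ a G) η + r′ b * 𝓚 (Δ b G) η
    exchange = begin
      r a * Δ a (𝓚 G) η + r b * Δ b (𝓚 G) η
        ≈⟨ +-cong (*-congˡ (Δ-a-𝓚 G η)) (*-cong rb≈raρ (Δ-b-𝓚 G η)) ⟩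
      α * forward (κ φ) A B + α * ρ * leave (κ φ) (λ i → κ (exits G η i)) A B
        ≈⟨ κ-exchange α φ (exits G η) A B ⟩
      κ (λ A B → α * ρ * forward φ A B + α * leave φ (exits G η) A B) A B
        ≈⟨ κ-linear _ α (leave φ (exits G η)) A B ⟩
      κ (λ A B → α * ρ * forward φ A B) A B + α * κ (leave φ (exits G η)) A B
        ≈⟨ +-congʳ (κ-scale (α * ρ) (forward φ) A B) ⟩
      α * ρ * κ (forward φ) A B + α * κ (leave φ (exits G η)) A B
        ≈⟨ +-cong (*-cong (trans r′a≈rb rb≈raρ) 𝓚Δ-a) (*-cong r′b≈ra 𝓚Δ-b) ⟨
      r′ a * 𝓚 (Δ a G) η + r′ b * 𝓚 (Δ b G) η ∎

    cancel : defect a + defect b ≈ 0#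
    cancel = begin
      defect a + defect b
        ≈⟨ solve 4 (λ p q x y → p :- x :+ (q :- y) := p :+ q :- (x :+ y)) refl _ _ _ _ ⟩
      r a * Δ a (𝓚 G) η + r b * Δ b (𝓚 G) η - (r′ a * 𝓚 (Δ a G) η + r′ b * 𝓚 (Δ b G) η)
        ≈⟨ +-congʳ exchange ⟩
      r′ a * 𝓚 (Δ a G) η + r′ b * 𝓚 (Δ b G) η - (r′ a * 𝓚 (Δ a G) η + r′ b * 𝓚 (Δ b G) η)
        ≈⟨ -‿inverseʳ _ ⟩
      0# ∎

-- Permutations as products of adjacent transpositions

module _ {n : ℕ} where

  open Components using () renaming (transpose to τ)

  τ-left : ∀ (i j : Fin n) → τ i j i ≡ j
  τ-left i j with i Fin.≟ i
  ... | yes _  = ≡.refl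
  ... | no i≢i = contradiction ≡.refl i≢i

  τ-right : ∀ (i j : Fin n) → τ i j j ≡ i
  τ-right i j with j Fin.≟ i
  ... | yes j≡i = j≡i
  ... | no  _ with j Fin.≟ j
  ...   | yes _  = ≡.refl
  ...   | no j≢j = contradiction ≡.refl j≢j

  τ-other : ∀ {i j k : Fin n} → k ≢ i → k ≢ j → τ i j k ≡ k
  τ-other {i} {j} {k} k≢i k≢j with k Fin.≟ i
  ... | yes k≡i = contradiction k≡i k≢i
  ... | no  _ with k Fin.≟ j
  ...   | yes k≡j = contradiction k≡j k≢j
  ...   | no  _   = ≡.refl

  τ-comm : ∀ (i j : Fin n) → τ i j ≗ τ j i
  τ-comm i j k = by-cases (k Fin.≟ i) (k Fin.≟ j)
    where
    by-cases : Dec (k ≡ i) → Dec (k ≡ j) → τ i j k ≡ τ j i k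
    by-cases (yes ≡.refl) _            = ≡.trans (τ-left k j) (≡.sym (τ-right j k))
    by-cases (no _)       (yes ≡.refl) = ≡.trans (τ-right i k) (≡.sym (τ-left k i))
    by-cases (no k≢i)     (no k≢j)     = ≡.trans (τ-other k≢i k≢j) (≡.sym (τ-other k≢j k≢i))

  τ-self : ∀ (i : Fin n) → τ i i ≗ id
  τ-self i k = by-cases (k Fin.≟ i)
    where
    by-cases : Dec (k ≡ i) → τ i i k ≡ k
    by-cases (yes ≡.refl) = τ-left k k
    by-cases (no k≢i)     = τ-other k≢i k≢i

  τ-conjugate : ∀ {i j k : Fin n} → i ≢ j → i ≢ k → j ≢ k → τ j k ∘ τ i j ∘ τ j k ≗ τ i k
  τ-conjugate {i} {j} {k} i≢j i≢k j≢k l = by-cases (l Fin.≟ i) (l Fin.≟ j) (l Fin.≟ k)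
    where
    open ≡.≡-Reasoning
    by-cases : Dec (l ≡ i) → Dec (l ≡ j) → Dec (l ≡ k) → τ j k (τ i j (τ j k l)) ≡ τ i k l
    by-cases (yes ≡.refl) _ _ = begin
      τ j k (τ i j (τ j k i)) ≡⟨ ≡.cong (τ j k ∘ τ i j) (τ-other i≢j i≢k) ⟩
      τ j k (τ i j i)         ≡⟨ ≡.cong (τ j k) (τ-left i j) ⟩
      τ j k j                 ≡⟨ τ-left j k ⟩
      k                       ≡⟨ τ-left i k ⟨
      τ i k i                 ∎
    by-cases (no l≢i) (yes ≡.refl) _ = begin
      τ j k (τ i j (τ j k j)) ≡⟨ ≡.cong (τ j k ∘ τ i j) (τ-left j k) ⟩
      τ j k (τ i j k)         ≡⟨ ≡.cong (τ j k) (τ-other (i≢k ∘ ≡.sym) (j≢k ∘ ≡.sym)) ⟩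
      τ j k k                 ≡⟨ τ-right j k ⟩
      j                       ≡⟨ τ-other l≢i j≢k ⟨
      τ i k j                 ∎
    by-cases (no l≢i) (no l≢j) (yes ≡.refl) = begin
      τ j k (τ i j (τ j k k)) ≡⟨ ≡.cong (τ j k ∘ τ i j) (τ-right j k) ⟩
      τ j k (τ i j j)         ≡⟨ ≡.cong (τ j k) (τ-right i j) ⟩
      τ j k i                 ≡⟨ τ-other i≢j i≢k ⟩
      i                       ≡⟨ τ-right i k ⟨
      τ i k k                 ∎
    by-cases (no l≢i) (no l≢j) (no l≢k) = begin
      τ j k (τ i j (τ j k l)) ≡⟨ ≡.cong (τ j k ∘ τ i j) (τ-other l≢j l≢k) ⟩
      τ j k (τ i j l)         ≡⟨ ≡.cong (τ j k) (τ-other l≢i l≢j) ⟩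
      τ j k l                 ≡⟨ τ-other l≢j l≢k ⟩
      l                       ≡⟨ τ-other l≢i l≢k ⟨
      τ i k l                 ∎

-- `decompose` emits a pair for every position, which at a fixed observed site is the trivial (i ,
-- i); hence the first alternative.
Admissible : ∀ {n} → ℕ → Fin n × Fin n → Set
Admissible ℓ (i , j) = i ≡ j ⊎ (ℓ ℕ.≤ toℕ i × ℓ ℕ.≤ toℕ j)

decompose-admissible : ∀ {n} ℓ (σ : Permutation′ n) → (∀ j → toℕ j ℕ.< ℓ → σ ⟨$⟩ʳ j ≡ j) →
                       All (Admissible ℓ) (decompose σ)
decompose-admissible {zero}  ℓ       σ fixed = []
decompose-admissible {suc n} zero    σ fixed = All.tabulate λ _ → inj₂ (ℕ.z≤n , ℕ.z≤n)
decompose-admissible {suc n} (suc ℓ) σ fixed =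
  inj₁ σ⁻¹0≡0 ∷ map⁺ (All.map shift (decompose-admissible ℓ σ′ fixed′))
  where
  σ⁻¹0≡0 : σ ⟨$⟩ˡ zero ≡ zero
  σ⁻¹0≡0 = ≡.trans (≡.cong (σ ⟨$⟩ˡ_) (≡.sym (fixed zero (ℕ.s≤s ℕ.z≤n)))) (inverseˡ σ)

  τσ = transpose zero (σ ⟨$⟩ˡ zero) ∘ₚ σ
  σ′ = removeₚ zero τσ

  τσ-fixed : ∀ j → toℕ j ℕ.< suc ℓ → τσ ⟨$⟩ʳ j ≡ j
  τσ-fixed j lt = ≡.trans (≡.cong (σ ⟨$⟩ʳ_)
    (≡.trans (≡.cong (λ i → Components.transpose zero i j) σ⁻¹0≡0) (τ-self zero j))) (fixed j lt)

  fixed′ : ∀ j → toℕ j ℕ.< ℓ → σ′ ⟨$⟩ʳ j ≡ j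
  fixed′ j lt = Fin.suc-injective (≡.trans (lift₀-remove τσ (τσ-fixed zero (ℕ.s≤s ℕ.z≤n)) (suc j))
    (τσ-fixed (suc j) (ℕ.s≤s lt)))

  shift : ∀ {p : Fin n × Fin n} → Admissible ℓ p → Admissible (suc ℓ) (suc (proj₁ p) , suc (proj₂ p))
  shift = Sum.map (≡.cong suc) λ (p , q) → ℕ.s≤s p , ℕ.s≤s q

-- The relation compares assignments of parameters to positions. `adjacent` is assumed at every f
-- because later swaps act on parameters that earlier ones have already rearranged.
module AdjacentTranspositions {n ℓ r} (_∼_ : Rel (Fin n → Fin n) r)
  (∼-reflexive : ∀ {f g} → f ≗ g → f ∼ g) (∼-trans : ∀ {f g h} → f ∼ g → g ∼ h → f ∼ h)
  (adjacent : ∀ f {i j} → ℓ ℕ.≤ toℕ i → toℕ j ≡ suc (toℕ i) → f ∼ (f ∘ Components.transpose i j)) where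

  open Components using () renaming (transpose to τ)

  private
    -- Induction on the distance: with j the position just before k, (i k) = (j k)(i j)(j k). All
    -- positions used lie at or above i, hence among the unobserved sites.
    ascending : ∀ d f {i j} → ℓ ℕ.≤ toℕ i → toℕ j ≡ suc (d ℕ.+ toℕ i) → f ∼ (f ∘ τ i j)
    ascending zero    f         ℓ≤i eq = adjacent f ℓ≤i eq
    ascending (suc d) f {i} {k} ℓ≤i eq =
      ∼-trans (adjacent f ℓ≤j k≡1+j)
        (∼-trans (ascending d (f ∘ τ j k) ℓ≤i j≡)
          (∼-trans (adjacent (f ∘ τ j k ∘ τ i j) ℓ≤j k≡1+j)
            (∼-reflexive λ l → ≡.cong f (τ-conjugate i≢j i≢k j≢k l))))
      where
      j<n : suc (d ℕ.+ toℕ i) ℕ.< n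
      j<n = ℕ.<-trans (ℕ.n<1+n _) (≡.subst (ℕ._< n) eq (Fin.toℕ<n k))
      j : Fin n
      j = Fin.fromℕ< j<n
      j≡ : toℕ j ≡ suc (d ℕ.+ toℕ i)
      j≡ = Fin.toℕ-fromℕ< j<n
      k≡1+j : toℕ k ≡ suc (toℕ j)
      k≡1+j = ≡.trans eq (≡.cong suc (≡.sym j≡))
      i<j : toℕ i ℕ.< toℕ j
      i<j = ≡.subst (toℕ i ℕ.<_) (≡.sym j≡) (ℕ.s≤s (ℕ.m≤n+m (toℕ i) d))
      j<k : toℕ j ℕ.< toℕ k
      j<k = ≡.subst (toℕ j ℕ.<_) (≡.sym k≡1+j) (ℕ.n<1+n _)
      ℓ≤j : ℓ ℕ.≤ toℕ j
      ℓ≤j = ℕ.≤-trans ℓ≤i (ℕ.<⇒≤ i<j)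
      i≢j : i ≢ j
      i≢j eq = ℕ.<⇒≢ i<j (≡.cong toℕ eq)
      i≢k : i ≢ k
      i≢k eq = ℕ.<⇒≢ (ℕ.<-trans i<j j<k) (≡.cong toℕ eq)
      j≢k : j ≢ k
      j≢k eq = ℕ.<⇒≢ j<k (≡.cong toℕ eq)

    ordered : ∀ f {i j} → ℓ ℕ.≤ toℕ i → toℕ i ℕ.< toℕ j → f ∼ (f ∘ τ i j)
    ordered f {i} {j} ℓ≤i i<j = ascending (toℕ j ℕ.∸ suc (toℕ i)) f ℓ≤i
      (≡.trans (≡.sym (ℕ.m∸n+n≡m i<j)) (ℕ.+-suc _ (toℕ i)))

    diagonal : ∀ f {i j} → i ≡ j → f ∼ (f ∘ τ i j)
    diagonal f {i} ≡.refl = ∼-reflexive λ k → ≡.cong f (≡.sym (τ-self i k))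

    transposition : ∀ f {i j} → Admissible ℓ (i , j) → f ∼ (f ∘ τ i j)
    transposition f         (inj₁ i≡j) = diagonal f i≡j
    transposition f {i} {j} (inj₂ (ℓ≤i , ℓ≤j)) with ℕ.<-cmp (toℕ i) (toℕ j)
    ... | tri< i<j _ _ = ordered f ℓ≤i i<j
    ... | tri≈ _ i≡j _ = diagonal f (Fin.toℕ-injective i≡j)
    ... | tri> _ _ j<i = ∼-trans (ordered f ℓ≤j j<i) (∼-reflexive λ k → ≡.cong f (τ-comm j i k))

    transpositions : ∀ f {ts} → All (Admissible ℓ) ts → f ∼ (f ∘ (eval ts ⟨$⟩ʳ_))
    transpositions f []       = ∼-reflexive λ _ → ≡.refl
    transpositions f {_ ∷ ts} (p ∷ ps) =
      ∼-trans (transpositions f ps) (transposition (f ∘ (eval ts ⟨$⟩ʳ_)) p)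

  permutation : ∀ f (σ : Permutation′ n) → (∀ j → toℕ j ℕ.< ℓ → σ ⟨$⟩ʳ j ≡ j) → f ∼ (f ∘ (σ ⟨$⟩ʳ_))
  permutation f σ fixed = ∼-trans (transpositions f (decompose-admissible ℓ σ fixed))
    (∼-reflexive λ k → ≡.cong f (eval-decompose σ k))

-- Interchanging the parameters of the process

module Interchangeability {c ℓ₁ ℓ₂ ℓ₃} (ℝ : Reals c ℓ₁ ℓ₂ ℓ₃) {n s ℓ : ℕ} (ℓ≤n : ℓ ℕ.≤ n) (type : Multiset s) where

  open Reals ℝ using (orderedField)
  open OrderedFieldProperties orderedField
  open Difference orderedField {n} {s}
  open Intertwining ℝ (finiteConfig n type)
  open Finite (finiteConfig n type) using (elements; enumeration; unique)
  open SetoidReasoning setoid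

  private variable
    f g : Config n type → Carrier
    r r′ r″ : Fin n → Carrier

  -- Extension by 0 outside the given content is linear in `f` and preserves bounds. The decision is
  -- an argument so that case distinctions can be made on it.
  extendBy : (Config n type → Carrier) → ∀ ζ → Dec (content ζ ≡ type) → Carrier
  extendBy f ζ (yes p) = f (ζ , p)
  extendBy f ζ (no _)  = 0#

  extend : (Config n type → Carrier) → Sites n s → Carrier
  extend f ζ = extendBy f ζ (content ζ ≟ₘ type)

  extend-config : ∀ f {ζ} (p : content ζ ≡ type) → extend f ζ ≡ f (ζ , p)
  extend-config f {ζ} p = by-cases (content ζ ≟ₘ type)
    where
    by-cases : ∀ d → extendBy f ζ d ≡ f (ζ , p)
    by-cases (yes q) = ≡.cong f (sites-injective ≡.refl)
    by-cases (no ¬p) = contradiction p ¬p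

  extend-sites : ∀ f η → extend f (sites η) ≡ f η
  extend-sites f η = extend-config f (content≡type η)

  extend-cong : (∀ η → f η ≈ g η) → ∀ ζ → extend f ζ ≈ extend g ζ
  extend-cong f≈g ζ with content ζ ≟ₘ type
  ... | yes _ = f≈g _
  ... | no  _ = refl

  extend-linear : ∀ f k g ζ → extend (λ η → f η + k * g η) ζ ≈ extend f ζ + k * extend g ζ
  extend-linear f k g ζ with content ζ ≟ₘ type
  ... | yes _ = refl
  ... | no  _ = solve 1 (λ k → :0 := :0 :+ k :* :0) refl k

  extend-* : ∀ (v : Sites n s → Carrier) f ζ → extend (λ η → v (sites η) * f η) ζ ≈ v ζ * extend f ζ
  extend-* v f ζ with content ζ ≟ₘ type
  ... | yes _ = refl
  ... | no  _ = sym (zeroʳ _)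

  extend-bound : ∀ {M} → 0# ≤ M → (∀ η → ∣ f η ∣≤ M) → ∀ ζ → ∣ extend f ζ ∣≤ M
  extend-bound 0≤M f≤M ζ with content ζ ≟ₘ type
  ... | yes _ = f≤M _
  ... | no  _ = ∣0∣≤ 0≤M

  extend-content : ∀ (G : Sites n s → Carrier) (η : Config n type) ζ → content ζ ≡ content (sites η) →
                   extend (G ∘ sites) ζ ≈ G ζ
  extend-content G η ζ eq = reflexive (extend-config (G ∘ sites) (≡.trans eq (content≡type η)))

  hopGenerator : (Fin n → Carrier) → (Config n type → Carrier) → Config n type → Carrier
  hopGenerator r f η = 𝓛 r (extend f) (sites η)

  -- The last three fields are the interface to path laws: `observes` moves K past an observation,
  -- `preserves-1` ends the list of observations, and `starts` discards K at the initial
  -- configuration.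
  record Interchange (r r′ : Fin n → Carrier) : Set (c ⊔ ℓ₁ ⊔ ℓ₃) where
    field
      K             : (Config n type → Carrier) → Config n type → Carrier
      boundedLinear : BoundedLinear K
      intertwines   : ∀ f η → hopGenerator r (K f) η ≈ K (hopGenerator r′ f) η
      observes      : ∀ (v : Sites ℓ s → Carrier) f η →
                      K (λ ζ → v (restrict ℓ≤n ζ) * f ζ) η ≈ v (restrict ℓ≤n η) * K f η
      preserves-1   : ∀ η → K (λ _ → 1#) η ≈ 1#
      starts        : ∀ f η → (∀ j → ℓ ℕ.≤ toℕ j → lookup (sites η) j ≡ ∅) → K f η ≈ f η

  Interchange-reflexive : (∀ j → r j ≈ r′ j) → Interchange r r′
  Interchange-reflexive r≈r′ = record
    { K             = id
    ; boundedLinear = record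
      { cong       = id
      ; linear     = λ _ _ _ _ → refl
      ; norm       = 1#
      ; 0≤norm     = <-weaken 0<1
      ; norm-bound = λ f≤M η → ∣∣≤-cong refl (sym (*-identityˡ _)) (f≤M η)
      }
    ; intertwines   = λ f η → ∑-cong (allFin n) λ j → *-congʳ (r≈r′ j)
    ; observes      = λ _ _ _ → refl
    ; preserves-1   = λ _ → refl
    ; starts        = λ _ _ _ → refl
    }

  Interchange-trans : Interchange r r′ → Interchange r′ r″ → Interchange r r″
  Interchange-trans X Y = record
    { K             = X.K ∘ Y.K
    ; boundedLinear = record
      { cong       = λ f≈g → X.cong (Y.cong f≈g)
      ; linear     = λ f k g η → trans (X.cong (Y.linear f k g) η) (X.linear (Y.K f) k (Y.K g) η)
      ; norm       = X.norm * Y.norm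
      ; 0≤norm     = *-nonneg X.0≤norm Y.0≤norm
      ; norm-bound = λ f≤M η → ∣∣≤-cong refl (sym (*-assoc _ _ _)) (X.norm-bound (Y.norm-bound f≤M) η)
      }
    ; intertwines   = λ f η → trans (X.intertwines (Y.K f) η) (X.cong (Y.intertwines f) η)
    ; observes      = λ v f η → trans (X.cong (Y.observes v f) η) (X.observes v (Y.K f) η)
    ; preserves-1   = λ η → trans (X.cong Y.preserves-1 η) (X.preserves-1 η)
    ; starts        = λ f η empty → trans (X.starts (Y.K f) η empty) (Y.starts f η empty)
    }
    where
    module X where
      open Interchange X public
      open BoundedLinear boundedLinear public
    module Y where
      open Interchange Y public
      open BoundedLinear boundedLinear public

  adjacent-interchange : 0 ℕ.< ℓ → ∀ {a b} → ℓ ℕ.≤ toℕ a → toℕ b ≡ suc (toℕ a) → ∀ {ρ} → 0# ≤ ρ →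
    r b ≈ r a * ρ → r′ a ≈ r b → r′ b ≈ r a → (∀ j → j ≢ a → j ≢ b → r′ j ≈ r j) → Interchange r r′
  adjacent-interchange {r} {r′} 0<ℓ {a} {b} ℓ≤a b≡1+a {ρ} 0≤ρ rb≈raρ r′a≈rb r′b≈ra r′≈r = record
    { K             = K
    ; boundedLinear = record
      { cong       = λ f≈g η → 𝓚-cong (sites η) λ ζ _ → extend-cong f≈g ζ
      ; linear     = λ f k g η → trans (𝓚-cong (sites η) λ ζ _ → extend-linear f k g ζ)
                                       (𝓚-linear (extend f) k (extend g) (sites η))
      ; norm       = proj₁ norms
      ; 0≤norm     = proj₁ (proj₂ norms)
      ; norm-bound = λ f≤M η → let 0≤M = ∣∣≤⇒0≤ (f≤M η) in
          ∣∣≤-weaken (≤-respˡ-≈ (*-comm _ _) (≤-respʳ-≈ (*-comm _ _)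
                       (*-monoʳ-≤ 0≤M (proj₂ (proj₂ (proj₂ norms) η)))))
                     (𝓚-bound 0≤ρ (extend-bound 0≤M f≤M) (sites η))
      }
    ; intertwines   = λ f η → begin
        𝓛 r (extend (K f)) (sites η)
          -- `extend (K f)` and `𝓚 (extend f)` need to agree only on the content of η, because hops
          -- conserve content.
          ≈⟨ ∑-cong (allFin n) (λ j → *-congˡ (Δ-cong j (sites η) λ ζ eq → extend-content (𝓚 (extend f)) η ζ eq)) ⟩
        𝓛 r (𝓚 (extend f)) (sites η)
          ≈⟨ 𝓚-intertwines rb≈raρ r′a≈rb r′b≈ra r′≈r (extend f) (sites η) ⟩
        𝓚 (𝓛 r′ (extend f)) (sites η)
          ≈⟨ 𝓚-cong (sites η) (λ ζ eq → extend-content (𝓛 r′ (extend f)) η ζ eq) ⟨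
        K (hopGenerator r′ f) η ∎
    ; observes      = λ v f η → trans
        (κ-cong′ (λ A B → trans (extend-* (v ∘ truncate ℓ≤n) f (put (sites η) A B))
          (*-congʳ (reflexive (≡.cong v (truncate-put (sites η) A B))))) _ _)
        (κ-scale _ (slice (extend f) (sites η)) _ _)
    ; preserves-1   = λ η → trans
        (𝓚-cong {H = λ _ → 1#} (sites η) λ ζ eq → extend-content (λ _ → 1#) η ζ eq) (κ-const 1# _ _)
    ; starts        = λ f η empty → trans
        (𝓚-empty (extend f) (sites η) (empty a ℓ≤a) (empty b ℓ≤b))
        (reflexive (extend-sites f η))
    }
    where
    open Exchange orderedField s (ℕ.<-≤-trans 0<ℓ ℓ≤a) b≡1+a ρ
    open Swapping orderedField {s} ρ
    open Put {n} {s} (a≢b b≡1+a)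

    K : (Config n type → Carrier) → Config n type → Carrier
    K f η = 𝓚 (extend f) (sites η)

    -- The bound for a single configuration depends on how many particles sit at b; finiteness of
    -- the set of configurations makes it uniform.
    norms = bounded λ η → scatterNorm (descending (lookup (sites η) b))

    ℓ≤b : ℓ ℕ.≤ toℕ b
    ℓ≤b = ℕ.≤-trans ℓ≤a (≡.subst (toℕ a ℕ.≤_) (≡.sym b≡1+a) (ℕ.n≤1+n _))

    truncate-put : ∀ η A B → truncate ℓ≤n (put η A B) ≡ truncate ℓ≤n η
    truncate-put η A B = ≡.trans (truncate-update ℓ≤n (η [ a ]≔ A) ℓ≤b) (truncate-update ℓ≤n η ℓ≤a)

  permuted-interchange : 0 ℕ.< ℓ → ∀ (r x : Fin n → Carrier) → (∀ j → 0# < r j) → (∀ j → 0# < x j) →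
    (∀ j → r j * x j ≈ 1#) → ∀ (σ : Permutation′ n) → (∀ j → toℕ j ℕ.< ℓ → σ ⟨$⟩ʳ j ≡ j) →
    Interchange r (λ j → r (σ ⟨$⟩ʳ j))
  permuted-interchange 0<ℓ r x r>0 x>0 rx≈1 = permutation id
    where
    adjacent : ∀ f {a b} → ℓ ℕ.≤ toℕ a → toℕ b ≡ suc (toℕ a) →
               Interchange (r ∘ f) (r ∘ f ∘ Components.transpose a b)
    -- This ρ is the ratio of the rate at b to the rate at a, with `x` serving as the reciprocal of
    -- `r`.
    adjacent f {a} {b} ℓ≤a b≡1+a = adjacent-interchange 0<ℓ ℓ≤a b≡1+a {r (f b) * x (f a)}
      (<-weaken (*-pos (r>0 (f b)) (x>0 (f a))))
      (sym (trans (solve 3 (λ p q y → p :* (q :* y) := q :* (p :* y)) refl (r (f a)) (r (f b)) (x (f a)))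
        (trans (*-congˡ (rx≈1 (f a))) (*-identityʳ _))))
      (reflexive (≡.cong (r ∘ f) (τ-left a b)))
      (reflexive (≡.cong (r ∘ f) (τ-right a b)))
      (λ j j≢a j≢b → reflexive (≡.cong (r ∘ f) (τ-other j≢a j≢b)))
  
    open AdjacentTranspositions {ℓ = ℓ} (λ f g → Interchange (r ∘ f) (r ∘ g))
      (λ f≗g → Interchange-reflexive λ j → reflexive (≡.cong r (f≗g j))) Interchange-trans adjacent

  module _ (r : Fin n → Carrier) where

    private
      jumps? : ∀ (η : Config n type) j (ζ : Config n type) → Dec (hop j (sites η) ≡ just (sites ζ))
      jumps? η j ζ = Maybe.≡-dec _≟ₛ_ (hop j (sites η)) (just (sites ζ))

    rate : Config n type → Config n type → Carrier
    rate η ζ = ∑ (allFin n) λ j → 𝟙 (jumps? η j ζ) * r j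

    hop-content : ∀ j (η : Sites n s) {ζ} → hop j η ≡ just ζ → content ζ ≡ content η
    hop-content j η eq with strongest (lookup η j) in top
    hop-content j η ≡.refl | just i = content-move η j top

    ∑-jumps : ∀ f η j → ∑ elements (λ ζ → 𝟙 (jumps? η j ζ) * (f ζ - f η)) ≈ Δ j (extend f) (sites η)
    ∑-jumps f η j = by-cases (hop j (sites η)) ≡.refl
      where
      by-cases : ∀ h → hop j (sites η) ≡ h →
        ∑ elements (λ ζ → 𝟙 (jumps? η j ζ) * (f ζ - f η)) ≈ maybe′ (λ ζ → extend f ζ - extend f (sites η)) 0# (hop j (sites η))
      by-cases nothing  eq = trans
        (∑-0 elements λ ζ → 𝟙-no (jumps? η j ζ) (λ eq′ → contradiction (≡.trans (≡.sym eq) eq′) λ ()) _)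
        (reflexive (≡.sym (≡.cong (maybe′ _ 0#) eq)))
      by-cases (just ζ) eq = trans
        (∑-𝟙 (jumps? η j) unique (enumeration ξ) eq
          (λ _ eq′ → sites-injective (Maybe.just-injective (≡.trans (≡.sym eq) eq′))))
        (reflexive (≡.trans (≡.sym (≡.cong₂ _-_ (extend-sites f ξ) (extend-sites f η)))
          (≡.sym (≡.cong (maybe′ _ 0#) eq))))
        where
        ξ : Config n type
        ξ = ζ , ≡.trans (hop-content j (sites η) eq) (content≡type η)

    -- Exchanging the sums over targets and sites separates the hops; each site then has at most one
    -- target, picked out by `∑-jumps`.
    generator-rate : ∀ f η → generator rate f η ≈ hopGenerator r f η
    generator-rate f η = begin
      ∑ elements (λ ζ → rate η ζ * (f ζ - f η))
        ≈⟨ ∑-cong elements (λ ζ → sym (∑-*ʳ (allFin n) (f ζ - f η) _)) ⟩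
      ∑ elements (λ ζ → ∑ (allFin n) λ j → 𝟙 (jumps? η j ζ) * r j * (f ζ - f η))
        ≈⟨ ∑-swap elements (allFin n) _ ⟩
      ∑ (allFin n) (λ j → ∑ elements λ ζ → 𝟙 (jumps? η j ζ) * r j * (f ζ - f η))
        ≈⟨ ∑-cong (allFin n) (λ j → trans
             (∑-cong elements λ ζ → solve 3 (λ p q y → p :* q :* y := q :* (p :* y)) refl _ (r j) _)
             (trans (∑-*ˡ elements (r j) _) (*-congˡ (∑-jumps f η j)))) ⟩
      hopGenerator r f η ∎

  same-path-law : ∀ {r r′} → Interchange r r′ → ∀ η → (∀ j → ℓ ℕ.≤ toℕ j → lookup (sites η) j ≡ ∅) →
    (W : JumpProcess ℝ (finiteConfig n type) (rate r)) (W′ : JumpProcess ℝ (finiteConfig n type) (rate r′)) →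
    SamePathLaw ℝ (finiteConfig n type) _≟ₛ_ (restrict ℓ≤n) W W′ η
  same-path-law {r} {r′} X η empty W W′ es increasing = trans
    (cylinder-intertwines W W′ boundedLinear intertwines′ _≟ₛ_ (restrict ℓ≤n) observes preserves-1 es increasing η)
    (starts _ η empty)
    where
    open Interchange X
    open BoundedLinear boundedLinear
    intertwines′ : ∀ f η → generator (rate r) (K f) η ≈ K (generator (rate r′) f) η
    intertwines′ f η = trans (generator-rate r (K f) η)
      (trans (intertwines f η) (cong (λ ζ → sym (generator-rate r′ f ζ)) η))

theorem7 : ∀ {c ℓ₁ ℓ₂ ℓ₃} (ℝ : Reals c ℓ₁ ℓ₂ ℓ₃) (let open Reals ℝ)
    (n ℓ s : ℕ) → 3 ℕ.≤ n → 1 ℕ.< ℓ → (ℓ<n : ℓ ℕ.< n) →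
    (type : Multiset s)
    (x : Fin n → Carrier) (x>0 : ∀ j → 0# < x j)
    (σ : Permutation′ n) → (∀ j → toℕ j ℕ.< ℓ → σ ⟨$⟩ʳ j ≡ j) →
    (η : Config n type) → (∀ j → ℓ ℕ.≤ toℕ j → lookup (sites η) j ≡ ∅) →
    (W  : mTAZRP ℝ type x x>0)
    (W′ : mTAZRP ℝ type (λ j → x (σ ⟨$⟩ʳ j)) (λ j → x>0 (σ ⟨$⟩ʳ j))) →
    SamePathLaw ℝ (finiteConfig n type) _≟ₛ_ (restrict (<⇒≤ ℓ<n)) W W′ η
theorem7 ℝ n ℓ s _ 1<ℓ ℓ<n type x x>0 σ fixed η empty W W′ =
  same-path-law (permuted-interchange (<⇒≤ 1<ℓ) r x r>0 x>0 rx≈1 σ fixed) η empty W W′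
  where
  open Interchangeability ℝ (<⇒≤ ℓ<n) type
  open OrderedFieldProperties (Reals.orderedField ℝ)
  r : Fin n → Carrier
  r j = recip (x j) (x>0 j)
  rx≈1 : ∀ j → r j * x j ≈ 1#
  rx≈1 j = recip-inverseˡ (x j) (x>0 j)
  r>0 : ∀ j → 0# < r j
  r>0 j = inverse-pos (x>0 j) (rx≈1 j)
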